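{- Let $C_1$ be an $[n,k,n-k]_qR_1$ NMDS code over $\mathbb{F}_q$, and for $m\ge1$ let $C_m$ be its $m$-lifted code, an $[n,k,n-k]_{q^m}R_m$ NMDS code over $\mathbb{F}_{q^m}$. Suppose $$A_{n-k}(C_1)=\binom{n}{k+1}\frac{q-1}{n-k}.$$ Then: (i) for every $m\ge n-k$, $R_m=n-k$ and $C_m$ is a UPWS NMDS code (so $\{C_m\}_{m\ge n-k}$ is an infinite family of UPWS NMDS codes); (ii) if $R_{m'}=n-k$ for some $m'<n-k$, then for every $m\ge m'$, $R_m=n-k$ and $C_m$ is a UPWS NMDS code.
   Context: An $[n,k,d]_qR$ code is a $k$-dimensional linear subspace of $\mathbb{F}_q^n$ with minimum Hamming distance $d$ and covering radius $R$ (least integer such that every vector of $\mathbb{F}_q^n$ is within distance $R$ of some codeword). $A_i(C)$ is the number of codewords of weight $i$. A linear $[n,k,n-k]_q$ code $C$ is near-MDS (NMDS) if its dual $C^\perp$ is an $[n,n-k,k]_q$ code. For a linear code $C$ over $\mathbb{F}_q$ with parity check matrix $H\in\mathbb{F}_q^{(n-k)\times n}$, the $m$-lifted code $C_m$ ($m\ge1$) is the code over $\mathbb{F}_{q^m}$ with the same parity check matrix: $C_m=\{x\in\mathbb{F}_{q^m}^n:Hx^T=0\}$ (the $\mathbb{F}_{q^m}$-span of $C$); it has the same length, dimension and minimum distance as $C$. $B_j(v,C)$ is the number of codewords at Hamming distance $j$ from $v$; a code with covering radius $R$ is uniformly packed in the wide sense (UPWS) if there are rationals $\beta_0,\dots,\beta_R$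 with $\sum_{j=0}^R\beta_jB_j(v,C)=1$ for all $v\in\mathbb{F}_q^n$. -}

module Defs where

open import Level using (0ℓ)
open import Data.Nat as ℕ using (ℕ; zero; suc; _≤_; _<_; _∸_)
open import Data.Fin using (Fin; zero; suc)
open import Data.Fin.Properties using (all?)
open import Data.List using (List; []; _∷_; map; concatMap; filter; length; allFin)
open import Data.Product using (Σ; ∃; _×_; _,_)
open import Data.Vec.Functional using (Vector) renaming (_∷_ to _∷ᵥ_)
open import Data.Rational as Q using (ℚ)
import Data.Integer
open import Function.Bundles using (_↔_)
open import Relation.Binary.PropositionalEquality using (_≡_; _≢_)
open import Relation.Nullary using (¬_; Dec; ¬?)
open import Relation.Nullary.Decidable using (_×-dec_)
open import Algebra.Structures using (IsCommutativeRing)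

record FiniteField : Set₁ where
  infixl 6 _+_
  infixl 7 _*_
  field
    Carrier : Set
    _+_ _*_ : Carrier → Carrier → Carrier
    -_ : Carrier → Carrier
    0# 1# : Carrier
    isCommutativeRing : IsCommutativeRing _≡_ _+_ _*_ -_ 0# 1#
    _≟_ : (x y : Carrier) → Dec (x ≡ y)
    0≢1 : 0# ≢ 1#
    inverse : ∀ x → x ≢ 0# → Σ Carrier λ y → x * y ≡ 1#
    size : ℕ
    enumeration : Carrier ↔ Fin size

open FiniteField public using (Carrier; size)

record IsFieldHom (F K : FiniteField) (ι : Carrier F → Carrier K) : Set where
  field
    hom-+ : ∀ x y → ι (FiniteField._+_ F x y) ≡ FiniteField._+_ K (ι x) (ι y)
    hom-* : ∀ x y → ι (FiniteField._*_ F x y) ≡ FiniteField._*_ K (ι x) (ι y)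
    hom-1 : ι (FiniteField.1# F) ≡ FiniteField.1# K

module _ (K : FiniteField) where
  private
    open module K = FiniteField K using () renaming (Carrier to A)

  Matrix : ℕ → ℕ → Set
  Matrix r n = Fin r → Fin n → A

  sumK : ∀ {n} → (Fin n → A) → A
  sumK {zero} f = K.0#
  sumK {suc n} f = K._+_ (f zero) (sumK (λ i → f (suc i)))

  elements : List A
  elements = map (Function.Bundles.Inverse.from (FiniteField.enumeration K)) (allFin (size K))

  allVectors : (n : ℕ) → List (Vector A n)
  allVectors zero = (λ ()) ∷ []
  allVectors (suc n) = concatMap (λ a → map (λ v → a ∷ᵥ v) (allVectors n)) elements

  countFin : ∀ {n} {P : Fin n → Set} → ((i : Fin n) → Dec (P i)) → ℕ
  countFin {n} P? = length (filter P? (allFin n))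

  wt : ∀ {n} → Vector A n → ℕ
  wt x = countFin (λ i → ¬? (x i K.≟ K.0#))

  dist : ∀ {n} → Vector A n → Vector A n → ℕ
  dist x y = countFin (λ i → ¬? (x i K.≟ y i))

  IsZero : ∀ {n} → Vector A n → Set
  IsZero x = ∀ i → x i ≡ K.0#

  InCode : ∀ {r n} → Matrix r n → Vector A n → Set
  InCode H x = ∀ j → sumK (λ i → K._*_ (H j i) (x i)) ≡ K.0#

  inCode? : ∀ {r n} (H : Matrix r n) (x : Vector A n) → Dec (InCode H x)
  inCode? H x = all? (λ j → sumK (λ i → K._*_ (H j i) (x i)) K.≟ K.0#)

  InDual : ∀ {r n} → Matrix r n → Vector A n → Set
  InDual {r} H y = Σ (Fin r → A) λ c → ∀ i → y i ≡ sumK (λ j → K._*_ (c j) (H j i))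

  -- rows of H linearly independent (so the code has dimension n - r)
  FullRank : ∀ {r n} → Matrix r n → Set
  FullRank {r} H = ∀ (c : Fin r → A) →
    (∀ i → sumK (λ j → K._*_ (c j) (H j i)) ≡ K.0#) → ∀ j → c j ≡ K.0#

  -- a set of vectors (given as a predicate) has minimum distance d
  -- (for a linear code: minimum weight of a nonzero codeword)
  HasMinDist : ∀ {n} → (Vector A n → Set) → ℕ → Set
  HasMinDist {n} C d =
    (∀ x → C x → ¬ IsZero x → d ≤ wt x) ×
    (Σ (Vector A n) λ x → C x × ¬ IsZero x × wt x ≡ d)

  IsNMDS : (n k : ℕ) → Matrix (n ∸ k) n → Set
  IsNMDS n k H = FullRank H × HasMinDist (InCode H) (n ∸ k) × HasMinDist (InDual H) k

  A[_] : ∀ {r n} → ℕ → Matrix r n → ℕ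
  A[_] {n = n} w H = length (filter (λ x → inCode? H x ×-dec (wt x ℕ.≟ w)) (allVectors n))

  B : ∀ {r n} → Matrix r n → ℕ → Vector A n → ℕ
  B {n = n} H j v = length (filter (λ x → inCode? H x ×-dec (dist v x ℕ.≟ j)) (allVectors n))

  Covers : ∀ {r n} → Matrix r n → ℕ → Set
  Covers {n = n} H R = ∀ (v : Vector A n) → Σ (Vector A n) λ c → InCode H c × dist v c ≤ R

  HasCoveringRadius : ∀ {r n} → Matrix r n → ℕ → Set
  HasCoveringRadius H R = Covers H R × (∀ R' → Covers H R' → R ≤ R')

  sumℚ : ∀ {n} → (Fin n → ℚ) → ℚ
  sumℚ {zero} f = Q.0ℚ
  sumℚ {suc n} f = f zero Q.+ sumℚ (λ i → f (suc i))

  -- uniformly packed in the wide sense, for covering radius R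
  IsUPWS : ∀ {r n} → Matrix r n → ℕ → Set
  IsUPWS {n = n} H R = Σ (Fin (suc R) → ℚ) λ β →
    ∀ (v : Vector A n) → sumℚ (λ j → β j Q.* (Data.Integer.+ (B H (Data.Fin.toℕ j) v) Q./ 1)) ≡ Q.1ℚ

lift : ∀ (F K : FiniteField) {r n} → (Carrier F → Carrier K) → Matrix F r n → Matrix K r n
lift F K ι H j i = ι (H j i)

{-# OPTIONS --safe #-}

-- Put r = n - k = t + 1. The dual distance k makes any r + 1 columns of H span, so two non-proportional codewords of
-- weight r share at most t - 1 support positions, and A_r attains the bound C(n,t) (q-1) / r exactly when the supports
-- form a Steiner system S(t, r, n). This property survives lifting. Let N_p(v) be the number of codewords that agree
-- with v outside p. For |p| = t and i outside p, N_{p+i}(v) is |K| N_p(v) if p + i is a block, and 1 otherwise.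
-- Summing over the flags (p, i) gives  r Σ_{|S|=r} N_S(v) = |K| Σ_{|p|=t} N_p(v) + C(n,t) k,  and both sums are
-- combinations of B_0(v), …, B_r(v) with coefficients independent of v; this is uniform packing.
-- A vector is within distance t of the code iff its syndrome s satisfies c·s = 0 for some c ≠ 0 over F orthogonal to t
-- columns of H. This depends only on the F-linear relations among the coordinates of s, which F-linear injections
-- preserve; coordinates that are linearly independent over F satisfy none.
module Submission where

open import Defs
open import Level using (0ℓ)
open import Algebra.Bundles using (CommutativeRing)
import Algebra.Properties.Ring as RingProperties
import Algebra.Properties.Semiring.Sum as SemiringSum
open import Data.Bool as Bool using (true; false; if_then_else_)
open import Data.Bool.Properties using (¬-not)
open import Data.Empty using (⊥-elim)
open import Data.Fin as Fin using (Fin; zero; suc; toℕ)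
import Data.Fin.Properties as Finₚ
open import Data.Fin.Subset using (Subset; ∣_∣) renaming (⊥ to ∅)
open import Data.Fin.Subset.Properties using (∣⊥∣≡0)
import Data.Integer as ℤ
import Data.Integer.Properties as ℤₚ
open import Data.List using (List; []; _∷_; _++_; map; concatMap; filter; length; allFin)
open import Data.List.Membership.Propositional using (_∈_)
open import Data.List.Membership.Propositional.Properties using (∈-++⁻; ∈-++⁺ˡ; ∈-++⁺ʳ; ∈-map⁺; ∈-map⁻)
open import Data.List.Properties using (length-map; length-tabulate; map-tabulate)
open import Data.List.Relation.Unary.Any using (here; there)
open import Data.Nat as ℕ using (ℕ; zero; suc; _+_; _*_; _∸_; _^_; _≤_; _<_; z≤n; s≤s)
open import Data.Nat.Combinatorics using (_C_; nCk+nC[k+1]≡[n+1]C[k+1]; nCk≡nC[n∸k])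
open import Data.Nat.Properties hiding (_≟_)
open import Data.Nat.Solver using (module +-*-Solver)
open import Data.Product using (Σ; ∃; ∃₂; _×_; _,_; proj₁; proj₂)
open import Data.Rational as ℚ using (ℚ)
import Data.Rational.Properties as ℚₚ
import Data.Rational.Solver as ℚ-Solver
open import Data.Rational.Unnormalised as ℚᵘ using (mkℚᵘ; *≡*)
import Data.Rational.Unnormalised.Properties as ℚᵘₚ
open import Data.Sum using (inj₁; inj₂)
open import Data.Vec using ([]; _∷_; lookup; _[_]≔_)
open import Data.Vec.Functional using (Vector; updateAt) renaming (_∷_ to _∷ᵥ_)
open import Data.Vec.Functional.Properties using (updateAt-updates; updateAt-minimal)
open import Data.Vec.Properties using (lookup∘updateAt; lookup∘updateAt′)
open import Function using (_∘_; id; const)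
open import Function.Bundles using (Inverse)
open import Relation.Binary.PropositionalEquality
open import Relation.Nullary using (¬_; Dec; yes; no; does; ¬?; contradiction)
open import Relation.Nullary.Decidable using (_×-dec_; _→-dec_; dec-true; dec-false; decidable-stable; map′)
open import Relation.Unary using (Decidable)

-- A set p of coordinates is read as a set of columns of H. The minimum distance makes any t columns
-- independent, so N_p(v) is 0 or 1 when |p| = t. If p + i is a block, multiples of a codeword
-- supported on it move the entry at i freely, whence the factor |K|; otherwise p + i is a basis of
-- columns, and exactly one codeword agrees with v outside it. Outside p there are one such block
-- point and k other points, and this is the origin of the constant C(n,t) k. For the covering
-- radius, t independent columns span a hyperplane, and since H has entries in F its normal vector c
-- can be taken over F in every extension. This makes syndromes over different extensions
-- comparable, although the fields `K m` come only with maps from F and with no maps among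
-- themselves. Kernel vectors, bases and dimensions are all obtained from cardinalities by the
-- pigeonhole principle.

⟦_⟧ : {P : Set} → Dec P → ℕ
⟦ p? ⟧ = if does p? then 1 else 0

⟦⟧-yes : {P : Set} (p? : Dec P) → P → ⟦ p? ⟧ ≡ 1
⟦⟧-yes p? p rewrite dec-true p? p = refl

⟦⟧-no : {P : Set} (p? : Dec P) → ¬ P → ⟦ p? ⟧ ≡ 0
⟦⟧-no p? ¬p rewrite dec-false p? ¬p = refl

⟦⟧≤1 : {P : Set} (p? : Dec P) → ⟦ p? ⟧ ≤ 1
⟦⟧≤1 (yes _) = ≤-refl
⟦⟧≤1 (no _) = z≤n

⟦⟧≢0 : {P : Set} (p? : Dec P) → ⟦ p? ⟧ ≢ 0 → P
⟦⟧≢0 (yes p) _ = p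
⟦⟧≢0 (no _) h = ⊥-elim (h refl)

⟦⟧-mono : {P Q : Set} (p? : Dec P) (q? : Dec Q) → (P → Q) → ⟦ p? ⟧ ≤ ⟦ q? ⟧
⟦⟧-mono (no _) q? f = z≤n
⟦⟧-mono (yes p) q? f = ≤-reflexive (sym (⟦⟧-yes q? (f p)))

⟦⟧-cong : {P Q : Set} (p? : Dec P) (q? : Dec Q) → (P → Q) → (Q → P) → ⟦ p? ⟧ ≡ ⟦ q? ⟧
⟦⟧-cong p? q? f g = ≤-antisym (⟦⟧-mono p? q? f) (⟦⟧-mono q? p? g)

⟦⟧-× : {P Q : Set} (p? : Dec P) (q? : Dec Q) → ⟦ p? ×-dec q? ⟧ ≡ ⟦ p? ⟧ * ⟦ q? ⟧
⟦⟧-× (no _) q? = refl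
⟦⟧-× (yes _) q? = sym (+-identityʳ _)

-- Finite sums of natural numbers

module _ {X : Set} where

  ∑ : List X → (X → ℕ) → ℕ
  ∑ [] f = 0
  ∑ (x ∷ xs) f = f x + ∑ xs f

  ∑-cong-∈ : ∀ xs {f g : X → ℕ} → (∀ {x} → x ∈ xs → f x ≡ g x) → ∑ xs f ≡ ∑ xs g
  ∑-cong-∈ [] h = refl
  ∑-cong-∈ (x ∷ xs) h = cong₂ _+_ (h (here refl)) (∑-cong-∈ xs (h ∘ there))

  ∑-cong : ∀ xs {f g : X → ℕ} → (∀ x → f x ≡ g x) → ∑ xs f ≡ ∑ xs g
  ∑-cong xs h = ∑-cong-∈ xs (λ {x} _ → h x)

  ∑-mono : ∀ xs {f g : X → ℕ} → (∀ x → f x ≤ g x) → ∑ xs f ≤ ∑ xs g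
  ∑-mono [] h = z≤n
  ∑-mono (x ∷ xs) h = +-mono-≤ (h x) (∑-mono xs h)

  ∑-+ : ∀ xs (f g : X → ℕ) → ∑ xs (λ x → f x + g x) ≡ ∑ xs f + ∑ xs g
  ∑-+ [] f g = refl
  ∑-+ (x ∷ xs) f g rewrite ∑-+ xs f g =
    solve 4 (λ a b c d → (a :+ b) :+ (c :+ d) := (a :+ c) :+ (b :+ d)) refl (f x) (g x) (∑ xs f) (∑ xs g)
    where open +-*-Solver using (solve; _:+_; _:*_; _:=_; con)

  ∑-*ˡ : ∀ xs c (f : X → ℕ) → ∑ xs (λ x → c * f x) ≡ c * ∑ xs f
  ∑-*ˡ [] c f = sym (*-zeroʳ c)
  ∑-*ˡ (x ∷ xs) c f rewrite ∑-*ˡ xs c f = sym (*-distribˡ-+ c (f x) (∑ xs f))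

  ∑-const : ∀ xs c → ∑ xs (λ _ → c) ≡ length xs * c
  ∑-const [] c = refl
  ∑-const (x ∷ xs) c = cong (c +_) (∑-const xs c)

  ∑-zero : ∀ xs {f : X → ℕ} → (∀ x → f x ≡ 0) → ∑ xs f ≡ 0
  ∑-zero xs h = trans (∑-cong xs h) (trans (∑-const xs 0) (*-zeroʳ (length xs)))

  ∑-++ : ∀ xs ys (f : X → ℕ) → ∑ (xs ++ ys) f ≡ ∑ xs f + ∑ ys f
  ∑-++ [] ys f = refl
  ∑-++ (x ∷ xs) ys f = trans (cong (f x +_) (∑-++ xs ys f)) (sym (+-assoc (f x) _ _))

  ∑≢0 : ∀ xs {f : X → ℕ} → ∑ xs f ≢ 0 → ∃ λ x → f x ≢ 0
  ∑≢0 [] h = ⊥-elim (h refl)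
  ∑≢0 (x ∷ xs) {f} h with f x ℕ.≟ 0
  ... | no fx≢0 = x , fx≢0
  ... | yes fx≡0 rewrite fx≡0 = ∑≢0 xs h

  ∈⇒≤∑ : ∀ {xs x} (f : X → ℕ) → x ∈ xs → f x ≤ ∑ xs f
  ∈⇒≤∑ f (here refl) = m≤m+n _ _
  ∈⇒≤∑ f (there x∈xs) = ≤-trans (∈⇒≤∑ f x∈xs) (m≤n+m _ _)

  -- Slack in one term cannot be made up by the others, which are bounded by `c` too. This turns the
  -- equality assumed for the number of minimum weight codewords into a statement about every single
  -- t-subset.
  ∑-tight : ∀ {xs x c} (f : X → ℕ) → (∀ {y} → y ∈ xs → f y ≤ c) → length xs * c ≤ ∑ xs f → x ∈ xs → f x ≡ c
  ∑-tight {y ∷ xs} {x} {c} f f≤c h x∈ = go x∈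
    where
    ∑≤ : ∀ ys → (∀ {y} → y ∈ ys → f y ≤ c) → ∑ ys f ≤ length ys * c
    ∑≤ [] _ = z≤n
    ∑≤ (y ∷ ys) b = +-mono-≤ (b (here refl)) (∑≤ ys (b ∘ there))
    tail≤ = ∑≤ xs (f≤c ∘ there)
    go : x ∈ y ∷ xs → f x ≡ c
    go (here refl) = ≤-antisym (f≤c (here refl))
      (+-cancelʳ-≤ (length xs * c) c (f y) (≤-trans h (+-monoʳ-≤ (f y) tail≤)))
    go (there x∈xs) = ∑-tight f (f≤c ∘ there)
      (+-cancelˡ-≤ c _ _ (≤-trans h (+-monoˡ-≤ _ (f≤c (here refl))))) x∈xs

  length-filter≡∑ : ∀ {P : X → Set} (P? : Decidable P) xs → length (filter P? xs) ≡ ∑ xs (λ x → ⟦ P? x ⟧)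
  length-filter≡∑ P? [] = refl
  length-filter≡∑ P? (x ∷ xs) with does (P? x)
  ... | true = cong suc (length-filter≡∑ P? xs)
  ... | false = length-filter≡∑ P? xs

∑-map : ∀ {X Y : Set} (h : Y → X) ys (f : X → ℕ) → ∑ (map h ys) f ≡ ∑ ys (f ∘ h)
∑-map h [] f = refl
∑-map h (y ∷ ys) f = cong (f (h y) +_) (∑-map h ys f)

∑-concatMap : ∀ {X Y : Set} (h : Y → List X) ys (f : X → ℕ) → ∑ (concatMap h ys) f ≡ ∑ ys (λ y → ∑ (h y) f)
∑-concatMap h [] f = refl
∑-concatMap h (y ∷ ys) f = trans (∑-++ (h y) _ f) (cong (∑ (h y) f +_) (∑-concatMap h ys f))

∑-swap : ∀ {X Y : Set} xs ys (f : X → Y → ℕ) → ∑ xs (λ x → ∑ ys (f x)) ≡ ∑ ys (λ y → ∑ xs (λ x → f x y))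
∑-swap [] ys f = sym (∑-zero ys (λ _ → refl))
∑-swap (x ∷ xs) ys f = trans (cong (∑ ys (f x) +_) (∑-swap xs ys f)) (sym (∑-+ ys _ _))

∑-allFin-suc : ∀ n (f : Fin (suc n) → ℕ) → ∑ (allFin (suc n)) f ≡ f zero + ∑ (allFin n) (f ∘ suc)
∑-allFin-suc n f = cong (f zero +_)
  (trans (cong (λ xs → ∑ xs f) (sym (map-tabulate id suc))) (∑-map suc (allFin n) f))

∑-allFin-≟ : ∀ {n} (i : Fin n) (g : Fin n → ℕ) → ∑ (allFin n) (λ j → ⟦ j Fin.≟ i ⟧ * g j) ≡ g i
∑-allFin-≟ {suc n} zero g = trans (∑-allFin-suc n _)
  (trans (cong₂ _+_ (+-identityʳ (g zero)) (∑-zero (allFin n) (λ _ → refl))) (+-identityʳ _))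
∑-allFin-≟ {suc n} (suc i) g = trans (∑-allFin-suc n (λ j → ⟦ j Fin.≟ suc i ⟧ * g j))
  (trans (∑-cong (allFin n) (λ j → cong (_* g (suc j)) (⟦⟧-cong (suc j Fin.≟ suc i) (j Fin.≟ i) Finₚ.suc-injective (cong suc))))
    (∑-allFin-≟ i (g ∘ suc)))

-- At most one term survives. It is applied to the points that complete a t-set to a block, of which
-- there is at most one.
∑-allFin-single : ∀ {n c} (f : Fin n → ℕ) → (∀ i → f i ≤ c) → (∀ i j → f i ≢ 0 → f j ≢ 0 → i ≡ j) →
  ∑ (allFin n) f ≤ c
∑-allFin-single {n} {c} f f≤c unique with ∑ (allFin n) f ℕ.≟ 0
... | yes eq = ≤-trans (≤-reflexive eq) z≤n
... | no neq with ∑≢0 (allFin n) neq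
... | i , fi≢0 = ≤-trans (∑-mono (allFin n) bound) (≤-reflexive (∑-allFin-≟ i (λ _ → c)))
  where
  bound : ∀ j → f j ≤ ⟦ j Fin.≟ i ⟧ * c
  bound j with f j ℕ.≟ 0
  ... | yes eq = ≤-trans (≤-reflexive eq) z≤n
  ... | no fj≢0 = ≤-trans (f≤c j) (≤-reflexive (sym
    (trans (cong (_* c) (⟦⟧-yes (j Fin.≟ i) (unique j i fj≢0 fi≢0))) (+-identityʳ c))))

-- Subsets of a given size and double counting

subsets : (n t : ℕ) → List (Subset n)
subsets zero zero = [] ∷ []
subsets zero (suc t) = []
subsets (suc n) zero = map (false ∷_) (subsets n zero)
subsets (suc n) (suc t) = map (true ∷_) (subsets n t) ++ map (false ∷_) (subsets n (suc t))

∑-subsets : ∀ n t (f : Subset (suc n) → ℕ) → ∑ (subsets (suc n) (suc t)) f ≡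
  ∑ (subsets n t) (f ∘ (true ∷_)) + ∑ (subsets n (suc t)) (f ∘ (false ∷_))
∑-subsets n t f = trans (∑-++ (map (true ∷_) (subsets n t)) _ f)
  (cong₂ _+_ (∑-map (true ∷_) (subsets n t) f) (∑-map (false ∷_) (subsets n (suc t)) f))

∈subsets⇒∣∣ : ∀ n t {p : Subset n} → p ∈ subsets n t → ∣ p ∣ ≡ t
∈subsets⇒∣∣ zero zero (here refl) = refl
∈subsets⇒∣∣ (suc n) zero h with ∈-map⁻ (false ∷_) h
... | p , p∈ , refl = ∈subsets⇒∣∣ n zero p∈
∈subsets⇒∣∣ (suc n) (suc t) h with ∈-++⁻ (map (true ∷_) (subsets n t)) h
... | inj₁ h′ with ∈-map⁻ (true ∷_) h′
...   | p , p∈ , refl = cong suc (∈subsets⇒∣∣ n t p∈)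
∈subsets⇒∣∣ (suc n) (suc t) h | inj₂ h′ with ∈-map⁻ (false ∷_) h′
...   | p , p∈ , refl = ∈subsets⇒∣∣ n (suc t) p∈

∈subsets : ∀ {n} (p : Subset n) → p ∈ subsets n ∣ p ∣
∈subsets [] = here refl
∈subsets {suc n} (true ∷ p) = ∈-++⁺ˡ (∈-map⁺ (true ∷_) (∈subsets p))
∈subsets {suc n} (false ∷ p) with ∣ p ∣ | ∈subsets p
... | zero | p∈ = ∈-map⁺ (false ∷_) p∈
... | suc t | p∈ = ∈-++⁺ʳ (map (true ∷_) (subsets n t)) (∈-map⁺ (false ∷_) p∈)

length≡∑1 : ∀ {X : Set} (xs : List X) → length xs ≡ ∑ xs (λ _ → 1)
length≡∑1 xs = sym (trans (∑-const xs 1) (*-identityʳ _))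

length-subsets : ∀ n t → length (subsets n t) ≡ n C t
length-subsets zero zero = refl
length-subsets zero (suc t) = refl
length-subsets (suc n) zero = trans (length-map (false ∷_) (subsets n zero)) (length-subsets n zero)
length-subsets (suc n) (suc t) = begin
  length (subsets (suc n) (suc t))                        ≡⟨ length≡∑1 (subsets (suc n) (suc t)) ⟩
  ∑ (subsets (suc n) (suc t)) (λ _ → 1)                   ≡⟨ ∑-subsets n t _ ⟩
  ∑ (subsets n t) (λ _ → 1) + ∑ (subsets n (suc t)) (λ _ → 1)
    ≡⟨ cong₂ _+_ (length≡∑1 (subsets n t)) (length≡∑1 (subsets n (suc t))) ⟨
  length (subsets n t) + length (subsets n (suc t))       ≡⟨ cong₂ _+_ (length-subsets n t) (length-subsets n (suc t)) ⟩
  n C t + n C suc t                                       ≡⟨ nCk+nC[k+1]≡[n+1]C[k+1] n t ⟩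
  suc n C suc t                                           ∎
  where open ≡-Reasoning

∣∣-insert : ∀ {n} (p : Subset n) i → lookup p i ≡ false → ∣ p [ i ]≔ true ∣ ≡ suc ∣ p ∣
∣∣-insert (false ∷ p) zero h = refl
∣∣-insert (false ∷ p) (suc i) h = ∣∣-insert p i h
∣∣-insert (true ∷ p) (suc i) h = cong suc (∣∣-insert p i h)

lookup-insert : ∀ {n} (p : Subset n) i → lookup (p [ i ]≔ true) i ≡ true
lookup-insert p i = lookup∘updateAt i p

lookup-insert-other : ∀ {n} (p : Subset n) {i j} → j ≢ i → lookup (p [ i ]≔ true) j ≡ lookup p j
lookup-insert-other p {i} {j} j≢i = lookup∘updateAt′ j i j≢i p

false∉insert : ∀ {n} (p : Subset n) {i j} → lookup (p [ i ]≔ true) j ≡ false → j ≢ i × lookup p j ≡ false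
false∉insert p {i} {j} h = j≢i , trans (sym (lookup-insert-other p j≢i)) h
  where
  j≢i : j ≢ i
  j≢i refl with trans (sym (lookup-insert p i)) h
  ... | ()

∃-outside : ∀ {n} (p : Subset n) → ∣ p ∣ < n → ∃ λ i → lookup p i ≡ false
∃-outside (false ∷ p) h = zero , refl
∃-outside (true ∷ p) (s≤s h) with ∃-outside p h
... | i , eq = suc i , eq

outside? : ∀ {n} (p : Subset n) i → Dec (lookup p i ≡ false)
outside? p i = lookup p i Bool.≟ false

∑-outside : ∀ {n} (p : Subset n) → ∑ (allFin n) (λ i → ⟦ outside? p i ⟧) + ∣ p ∣ ≡ n
∑-outside [] = refl
∑-outside {suc n} (true ∷ p) = trans (cong (_+ suc ∣ p ∣) (∑-allFin-suc n (λ i → ⟦ outside? (true ∷ p) i ⟧)))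
  (trans (+-suc _ _) (cong suc (∑-outside p)))
∑-outside {suc n} (false ∷ p) = trans (cong (_+ ∣ p ∣) (∑-allFin-suc n (λ i → ⟦ outside? (false ∷ p) i ⟧)))
  (cong suc (∑-outside p))

-- Double counting of the flags T ⊂ T ∪ {i}.
∑-flags : ∀ n t (f : Subset n → ℕ) → suc t * ∑ (subsets n (suc t)) f ≡
  ∑ (subsets n t) (λ p → ∑ (allFin n) (λ i → ⟦ outside? p i ⟧ * f (p [ i ]≔ true)))
∑-flags zero zero f = refl
∑-flags zero (suc t) f = *-zeroʳ (suc (suc t))
∑-flags (suc n) t f = sym (begin
  ∑ (subsets (suc n) t) row                                ≡⟨ split t ⟩
  below t + (∑ (subsets n t) (f ∘ (true ∷_)) + suc t * ∑ (subsets n (suc t)) (f ∘ (false ∷_)))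
                                                           ≡⟨ cong₂ _+_ (below≡ t) refl ⟩
  t * ∑ (subsets n t) (f ∘ (true ∷_)) + (∑ (subsets n t) (f ∘ (true ∷_)) + suc t * ∑ (subsets n (suc t)) (f ∘ (false ∷_)))
    ≡⟨ solve 3 (λ t a b → t :* a :+ (a :+ (con 1 :+ t) :* b) := (con 1 :+ t) :* (a :+ b)) refl
         t (∑ (subsets n t) (f ∘ (true ∷_))) (∑ (subsets n (suc t)) (f ∘ (false ∷_))) ⟩
  suc t * (∑ (subsets n t) (f ∘ (true ∷_)) + ∑ (subsets n (suc t)) (f ∘ (false ∷_)))
                                                           ≡⟨ cong (suc t *_) (∑-subsets n t f) ⟨
  suc t * ∑ (subsets (suc n) (suc t)) f                    ∎)
  where
  open ≡-Reasoning
  open +-*-Solver using (solve; _:+_; _:*_; _:=_; con)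
  row : Subset (suc n) → ℕ
  row p = ∑ (allFin (suc n)) (λ i → ⟦ outside? p i ⟧ * f (p [ i ]≔ true))
  row′ : (Subset n → ℕ) → Subset n → ℕ
  row′ g p = ∑ (allFin n) (λ i → ⟦ outside? p i ⟧ * g (p [ i ]≔ true))
  -- The contribution of the `t`-subsets containing `zero`: none for `t` equal to 0, otherwise a
  -- flag sum over one point fewer. The subsets avoiding `zero` also contribute the flags that add
  -- `zero` itself.
  below : ℕ → ℕ
  below zero = 0
  below (suc t) = ∑ (subsets n t) (row′ (f ∘ (true ∷_)))
  below≡ : ∀ t → below t ≡ t * ∑ (subsets n t) (f ∘ (true ∷_))
  below≡ zero = refl
  below≡ (suc t) = sym (∑-flags n t (f ∘ (true ∷_)))
  row-true : ∀ p → row (true ∷ p) ≡ row′ (f ∘ (true ∷_)) p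
  row-true p = ∑-allFin-suc n (λ i → ⟦ outside? (true ∷ p) i ⟧ * f ((true ∷ p) [ i ]≔ true))
  row-false : ∀ p → row (false ∷ p) ≡ f (true ∷ p) + row′ (f ∘ (false ∷_)) p
  row-false p = trans (∑-allFin-suc n (λ i → ⟦ outside? (false ∷ p) i ⟧ * f ((false ∷ p) [ i ]≔ true)))
    (cong₂ _+_ (+-identityʳ (f (true ∷ p))) refl)
  rows-false : ∀ t → ∑ (subsets n t) (row ∘ (false ∷_)) ≡
    ∑ (subsets n t) (f ∘ (true ∷_)) + suc t * ∑ (subsets n (suc t)) (f ∘ (false ∷_))
  rows-false t = trans (∑-cong (subsets n t) row-false)
    (trans (∑-+ (subsets n t) _ _) (cong₂ _+_ refl (sym (∑-flags n t (f ∘ (false ∷_))))))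
  split : ∀ t → ∑ (subsets (suc n) t) row ≡
    below t + (∑ (subsets n t) (f ∘ (true ∷_)) + suc t * ∑ (subsets n (suc t)) (f ∘ (false ∷_)))
  split zero = trans (∑-map (false ∷_) (subsets n zero) row) (rows-false zero)
  split (suc t) = trans (∑-subsets n t row)
    (cong₂ _+_ (∑-cong (subsets n t) row-true) (rows-false (suc t)))

-- The number of t-subsets containing a fixed j-subset of a set of size j + z.
supersets : (j z t : ℕ) → ℕ
supersets zero z t = z C t
supersets (suc j) z zero = 0
supersets (suc j) z (suc t) = supersets j z t

-- The additional point of the complement is either taken or left out.
supersets-pascal : ∀ j z t → supersets j (suc z) (suc t) ≡ supersets j z t + supersets j z (suc t)
supersets-pascal zero z t = sym (nCk+nC[k+1]≡[n+1]C[k+1] z t)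
supersets-pascal (suc zero) z zero = refl
supersets-pascal (suc (suc j)) z zero = refl
supersets-pascal (suc j) z (suc t) = supersets-pascal j z t

supersets-small : ∀ j z t → t < j → supersets j z t ≡ 0
supersets-small (suc j) z zero h = refl
supersets-small (suc j) z (suc t) (s≤s h) = supersets-small j z t h

-- The increasing enumeration of `p`. Composing with it restricts a matrix to the columns in `p`, so
-- that linear systems on these columns have unknowns or equations indexed by `Fin`.
pos : ∀ {n} (p : Subset n) → Fin ∣ p ∣ → Fin n
pos (true ∷ p) zero = zero
pos (true ∷ p) (suc l) = suc (pos p l)
pos (false ∷ p) l = suc (pos p l)

pos-surjective : ∀ {n} (p : Subset n) {i} → lookup p i ≡ true → ∃ λ l → pos p l ≡ i
pos-surjective (true ∷ p) {zero} h = zero , refl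
pos-surjective (true ∷ p) {suc i} h with pos-surjective p h
... | l , refl = suc l , refl
pos-surjective (false ∷ p) {suc i} h with pos-surjective p h
... | l , refl = l , refl

countFin-suc : ∀ K {n} {P : Fin (suc n) → Set} (P? : Decidable P) →
  countFin K P? ≡ ⟦ P? zero ⟧ + countFin K (P? ∘ suc)
countFin-suc K {n} P? = trans (length-filter≡∑ P? (allFin (suc n)))
  (trans (∑-allFin-suc n (λ i → ⟦ P? i ⟧)) (cong (⟦ P? zero ⟧ +_) (sym (length-filter≡∑ (P? ∘ suc) (allFin n)))))

countFin-mono : ∀ K L {n} {P Q : Fin n → Set} (P? : Decidable P) (Q? : Decidable Q) →
  (∀ i → P i → Q i) → countFin K P? ≤ countFin L Q?
countFin-mono K L {n} P? Q? P⇒Q rewrite length-filter≡∑ P? (allFin n) | length-filter≡∑ Q? (allFin n) =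
  ∑-mono (allFin n) (λ i → ⟦⟧-mono (P? i) (Q? i) (P⇒Q i))

funToFin-cong : ∀ {m n} {f g : Fin m → Fin n} → f ≗ g → Fin.funToFin f ≡ Fin.funToFin g
funToFin-cong {zero} f≗g = refl
funToFin-cong {suc m} f≗g = cong₂ Fin.combine (f≗g zero) (funToFin-cong (f≗g ∘ suc))

-- Linear algebra, distances and enumeration of vectors over a finite field

module FieldLemmas (K : FiniteField) where
  open FiniteField K public using (isCommutativeRing; _≟_; 0≢1; inverse; enumeration; 0#; 1#)
    renaming (_+_ to infixl 6 _⊕_; _*_ to infixl 7 _⊗_; -_ to infix 8 ⊖_)

  A : Set
  A = Carrier K

  ring : CommutativeRing 0ℓ 0ℓ
  ring = record { isCommutativeRing = isCommutativeRing }

  module R = CommutativeRing ring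
  module RP = RingProperties R.ring
  private module S = SemiringSum R.semiring

  sumK≡sum : ∀ {n} (f : Fin n → A) → sumK K f ≡ S.sum f
  sumK≡sum {zero} f = refl
  sumK≡sum {suc n} f = cong (f zero ⊕_) (sumK≡sum (f ∘ suc))

  sumK-cong : ∀ {n} {f g : Fin n → A} → f ≗ g → sumK K f ≡ sumK K g
  sumK-cong {zero} h = refl
  sumK-cong {suc n} h = cong₂ _⊕_ (h zero) (sumK-cong (h ∘ suc))

  sumK-⊕ : ∀ {n} (f g : Fin n → A) → sumK K (λ i → f i ⊕ g i) ≡ sumK K f ⊕ sumK K g
  sumK-⊕ f g = trans (sumK≡sum (λ i → f i ⊕ g i)) (trans (S.∑-distrib-+ f g) (sym (cong₂ _⊕_ (sumK≡sum f) (sumK≡sum g))))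

  sumK-⊗ˡ : ∀ {n} c (f : Fin n → A) → sumK K (λ i → c ⊗ f i) ≡ c ⊗ sumK K f
  sumK-⊗ˡ c f = trans (sumK≡sum (λ i → c ⊗ f i)) (trans (sym (S.*-distribˡ-sum c f)) (cong (c ⊗_) (sym (sumK≡sum f))))

  sumK-⊗ʳ : ∀ {n} (f : Fin n → A) c → sumK K (λ i → f i ⊗ c) ≡ sumK K f ⊗ c
  sumK-⊗ʳ f c = trans (sumK-cong (λ i → R.*-comm (f i) c)) (trans (sumK-⊗ˡ c f) (R.*-comm c _))

  sumK-swap : ∀ {m n} (f : Fin m → Fin n → A) →
    sumK K (λ i → sumK K (f i)) ≡ sumK K (λ j → sumK K (λ i → f i j))
  sumK-swap f = trans (unfold f) (trans (S.∑-comm f) (sym (unfold (λ j i → f i j))))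
    where
    unfold : ∀ {m n} (f : Fin m → Fin n → A) → sumK K (λ i → sumK K (f i)) ≡ S.sum (λ i → S.sum (f i))
    unfold f = trans (sumK-cong (λ i → sumK≡sum (f i))) (sumK≡sum (λ i → S.sum (f i)))

  sumK-zero : ∀ {n} {f : Fin n → A} → (∀ i → f i ≡ 0#) → sumK K f ≡ 0#
  sumK-zero {zero} h = refl
  sumK-zero {suc n} h = trans (cong₂ _⊕_ (h zero) (sumK-zero (h ∘ suc))) (R.+-identityˡ 0#)

  sumK-single : ∀ {n} {f : Fin n → A} i → (∀ j → j ≢ i → f j ≡ 0#) → sumK K f ≡ f i
  sumK-single {suc n} {f} zero h =
    trans (cong (f zero ⊕_) (sumK-zero (λ j → h (suc j) λ ()))) (R.+-identityʳ _)
  sumK-single {suc n} {f} (suc i) h =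
    trans (cong₂ _⊕_ (h zero λ ()) (sumK-single i (λ j j≢i → h (suc j) (j≢i ∘ Finₚ.suc-injective)))) (R.+-identityˡ _)

  dot-⊕ : ∀ {n} (g x y : Fin n → A) a →
    sumK K (λ i → g i ⊗ (a ⊗ x i ⊕ y i)) ≡ a ⊗ sumK K (λ i → g i ⊗ x i) ⊕ sumK K (λ i → g i ⊗ y i)
  dot-⊕ g x y a = begin
    sumK K (λ i → g i ⊗ (a ⊗ x i ⊕ y i))                     ≡⟨ sumK-cong (λ i → trans (R.distribˡ _ _ _) (cong (_⊕ g i ⊗ y i) (commute i))) ⟩
    sumK K (λ i → a ⊗ (g i ⊗ x i) ⊕ g i ⊗ y i)               ≡⟨ sumK-⊕ (λ i → a ⊗ (g i ⊗ x i)) (λ i → g i ⊗ y i) ⟩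
    sumK K (λ i → a ⊗ (g i ⊗ x i)) ⊕ sumK K (λ i → g i ⊗ y i) ≡⟨ cong (_⊕ sumK K (λ i → g i ⊗ y i)) (sumK-⊗ˡ a (λ i → g i ⊗ x i)) ⟩
    a ⊗ sumK K (λ i → g i ⊗ x i) ⊕ sumK K (λ i → g i ⊗ y i)  ∎
    where
    open ≡-Reasoning
    commute : ∀ i → g i ⊗ (a ⊗ x i) ≡ a ⊗ (g i ⊗ x i)
    commute i = trans (sym (R.*-assoc _ _ _)) (trans (cong (_⊗ x i) (R.*-comm (g i) a)) (R.*-assoc _ _ _))

  integral : ∀ {x y} → x ≢ 0# → x ⊗ y ≡ 0# → y ≡ 0#
  integral {x} {y} x≢0 xy≡0 with inverse x x≢0
  ... | z , xz≡1 = begin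
    y             ≡⟨ R.*-identityˡ y ⟨
    1# ⊗ y        ≡⟨ cong (_⊗ y) (trans (R.*-comm z x) xz≡1) ⟨
    z ⊗ x ⊗ y     ≡⟨ R.*-assoc z x y ⟩
    z ⊗ (x ⊗ y)   ≡⟨ cong (z ⊗_) xy≡0 ⟩
    z ⊗ 0#        ≡⟨ R.zeroʳ z ⟩
    0#            ∎
    where open ≡-Reasoning

  -1x+x≡0 : ∀ x → ⊖ 1# ⊗ x ⊕ x ≡ 0#
  -1x+x≡0 x = trans (cong (_⊕ x) (RP.-1*x≈-x x)) (R.-‿inverseˡ x)

  -1x+y≡0⇒x≡y : ∀ {x y} → ⊖ 1# ⊗ x ⊕ y ≡ 0# → x ≡ y
  -1x+y≡0⇒x≡y {x} {y} h = sym (RP.x∙y⁻¹≈ε⇒x≈y y x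
    (trans (R.+-comm y _) (trans (cong (_⊕ y) (sym (RP.-1*x≈-x x))) h)))

  open Inverse enumeration public using (to; from; strictlyInverseˡ; strictlyInverseʳ)

  to-injective : ∀ {a b} → to a ≡ to b → a ≡ b
  to-injective {a} {b} h = trans (sym (strictlyInverseʳ a)) (trans (cong from h) (strictlyInverseʳ b))

  from-injective : ∀ {i j} → from i ≡ from j → i ≡ j
  from-injective {i} {j} h = trans (sym (strictlyInverseˡ i)) (trans (cong to h) (strictlyInverseˡ j))

  1<size : 1 < size K
  1<size = distinct (to 0#) (to 1#) (0≢1 ∘ to-injective)
    where
    distinct : ∀ {s} (i j : Fin s) → i ≢ j → 1 < s
    distinct {suc zero} zero zero h = contradiction refl h
    distinct {suc (suc s)} i j h = s≤s (s≤s z≤n)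

  -- Numbering the vectors makes the pigeonhole principle on `Fin` applicable; equality of codes is
  -- pointwise equality of vectors.
  encode : ∀ {n} → Vector A n → Fin (size K ^ n)
  encode x = Fin.funToFin (to ∘ x)

  decode : ∀ {n} → Fin (size K ^ n) → Vector A n
  decode i = from ∘ Fin.finToFun i

  decode-encode : ∀ {n} (x : Vector A n) → decode (encode x) ≗ x
  decode-encode x i = trans (cong from (Finₚ.finToFun-funToFin (to ∘ x) i)) (strictlyInverseʳ (x i))

  encode-injective : ∀ {n} {x y : Vector A n} → encode x ≡ encode y → x ≗ y
  encode-injective {x = x} {y} h i =
    trans (sym (decode-encode x i)) (trans (cong (λ c → decode c i) h) (decode-encode y i))

  decode-injective : ∀ {n} {i j : Fin (size K ^ n)} → decode {n} i ≗ decode j → i ≡ j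
  decode-injective {n} {i} {j} h = trans (sym (Finₚ.funToFin-finToFin {n} i))
    (trans (funToFin-cong (from-injective ∘ h)) (Finₚ.funToFin-finToFin {n} j))

  ≗? : ∀ {n} (x y : Vector A n) → Dec (∀ i → x i ≡ y i)
  ≗? x y = Finₚ.all? (λ i → x i ≟ y i)

  collision : ∀ {n N} (f : Vector A n → Fin N) → N < size K ^ n →
    ∃₂ λ x y → ¬ x ≗ y × f x ≡ f y
  collision {n} f N< with Finₚ.pigeonhole N< (f ∘ decode)
  ... | i , j , i<j , eq = decode i , decode j , (λ h → Finₚ.<⇒≢ i<j (decode-injective {n} h)) , eq

  ¬IsZero⇒∃ : ∀ {n} (x : Vector A n) → ¬ IsZero K x → ∃ λ i → x i ≢ 0#
  ¬IsZero⇒∃ {n} x = Finₚ.¬∀⟶∃¬ n _ (λ i → x i ≟ 0#)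

  -- A counting substitute for elimination: `M` takes more vectors than it has possible values, so
  -- two distinct vectors have the same image, and their difference lies in the kernel.
  nontrivial-solution : ∀ {r n} (M : Matrix K r n) → r < n → ∃ λ x → InCode K M x × ¬ IsZero K x
  nontrivial-solution M r<n with collision (λ x → encode (λ j → sumK K (λ i → M j i ⊗ x i))) (^-monoʳ-< (size K) 1<size r<n)
  ... | x , y , x≢y , eq = (λ i → ⊖ 1# ⊗ x i ⊕ y i)
    , (λ j → trans (dot-⊕ (M j) x y (⊖ 1#))
        (trans (cong (λ s → ⊖ 1# ⊗ s ⊕ sumK K (λ i → M j i ⊗ y i)) (encode-injective eq j)) (-1x+x≡0 _)))
    , λ h → x≢y (λ i → -1x+y≡0⇒x≡y (h i))

  -- Extension by zero, the counterpart of restriction along `pos`.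
  spread : ∀ {n} (p : Subset n) → Vector A ∣ p ∣ → Vector A n
  spread (true ∷ p) y zero = y zero
  spread (true ∷ p) y (suc i) = spread p (y ∘ suc) i
  spread (false ∷ p) y zero = 0#
  spread (false ∷ p) y (suc i) = spread p y i

  spread-outside : ∀ {n} (p : Subset n) y i → lookup p i ≡ false → spread p y i ≡ 0#
  spread-outside (true ∷ p) y (suc i) h = spread-outside p (y ∘ suc) i h
  spread-outside (false ∷ p) y zero h = refl
  spread-outside (false ∷ p) y (suc i) h = spread-outside p y i h

  spread-pos : ∀ {n} (p : Subset n) y l → spread p y (pos p l) ≡ y l
  spread-pos (true ∷ p) y zero = refl
  spread-pos (true ∷ p) y (suc l) = spread-pos p (y ∘ suc) l
  spread-pos (false ∷ p) y l = spread-pos p y l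

  sumK-spread : ∀ {n} (p : Subset n) (g : Vector A n) y →
    sumK K (λ i → g i ⊗ spread p y i) ≡ sumK K (λ l → g (pos p l) ⊗ y l)
  sumK-spread [] g y = refl
  sumK-spread (true ∷ p) g y = cong (g zero ⊗ y zero ⊕_) (sumK-spread p (g ∘ suc) (y ∘ suc))
  sumK-spread (false ∷ p) g y =
    trans (cong₂ _⊕_ (R.zeroʳ (g zero)) (sumK-spread p (g ∘ suc) y)) (R.+-identityˡ _)

  -- The set `p` is where errors are allowed: only the coordinates outside it are compared.
  Agree : ∀ {n} → Subset n → Vector A n → Vector A n → Set
  Agree p v x = ∀ i → lookup p i ≡ false → v i ≡ x i

  agree? : ∀ {n} (p : Subset n) v x → Dec (Agree p v x)
  agree? p v x = Finₚ.all? (λ i → outside? p i →-dec (v i ≟ x i))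

  Supported : ∀ {n} → Subset n → Vector A n → Set
  Supported p x = ∀ i → lookup p i ≡ false → x i ≡ 0#

  dist-suc : ∀ {n} (v x : Vector A (suc n)) → dist K v x ≡ ⟦ ¬? (v zero ≟ x zero) ⟧ + dist K (v ∘ suc) (x ∘ suc)
  dist-suc v x = countFin-suc K (λ i → ¬? (v i ≟ x i))

  dist≤n : ∀ {n} (v x : Vector A n) → dist K v x ≤ n
  dist≤n {zero} v x = z≤n
  dist≤n {suc n} v x rewrite dist-suc v x = +-mono-≤ (⟦⟧≤1 (¬? (v zero ≟ x zero))) (dist≤n (v ∘ suc) (x ∘ suc))

  dist≤∣∣ : ∀ {n} (p : Subset n) {v x} → Agree p v x → dist K v x ≤ ∣ p ∣
  dist≤∣∣ [] h = z≤n
  dist≤∣∣ (true ∷ p) {v} {x} h rewrite dist-suc v x =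
    +-mono-≤ (⟦⟧≤1 (¬? (v zero ≟ x zero))) (dist≤∣∣ p (h ∘ suc))
  dist≤∣∣ (false ∷ p) {v} {x} h rewrite dist-suc v x | ⟦⟧-no (¬? (v zero ≟ x zero)) (λ k → k (h zero refl)) =
    dist≤∣∣ p (h ∘ suc)

  -- The set of differing coordinates is padded to size exactly `t`, since the counting arguments
  -- concern subsets of a fixed size.
  dist-subset : ∀ {n t} (v x : Vector A n) → dist K v x ≤ t → t ≤ n → ∃ λ p → ∣ p ∣ ≡ t × Agree p v x
  dist-subset {zero} {zero} v x d≤t t≤n = [] , refl , λ ()
  dist-subset {suc n} {t} v x d≤t t≤n with v zero ≟ x zero | dist-suc v x
  dist-subset {suc n} {suc t} v x d≤t (s≤s t≤n) | no _ | eq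
    with dist-subset {n} {t} (v ∘ suc) (x ∘ suc) (≤-pred (≤-trans (≤-reflexive (sym eq)) d≤t)) t≤n
  ... | p , ∣p∣ , agree = true ∷ p , cong suc ∣p∣ , λ { (suc i) → agree i }
  dist-subset {suc n} {zero} v x d≤t t≤n | no _ | eq with trans (sym eq) (n≤0⇒n≡0 d≤t)
  ... | ()
  dist-subset {suc n} {t} v x d≤t t≤n | yes v≡x | eq with t ≤? n
  ... | yes t≤n′ with dist-subset {n} {t} (v ∘ suc) (x ∘ suc) (≤-trans (≤-reflexive (sym eq)) d≤t) t≤n′
  ...   | p , ∣p∣ , agree = false ∷ p , ∣p∣ , λ { zero _ → v≡x ; (suc i) → agree i }
  -- Now `t` is `suc n`: every coordinate has to be taken, including this one, where the vectors
  -- agree.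
  dist-subset {suc n} {t} v x d≤t t≤n | yes v≡x | eq | no t≰n with ≤-antisym t≤n (≰⇒> t≰n)
  ... | refl with dist-subset {n} {n} (v ∘ suc) (x ∘ suc) (dist≤n _ _) ≤-refl
  ...   | p , ∣p∣ , agree = true ∷ p , cong suc ∣p∣ , λ { (suc i) → agree i }

  wt+zeros≤n : ∀ {n} (p : Subset n) (y : Vector A n) → (∀ i → lookup p i ≡ true → y i ≡ 0#) → wt K y + ∣ p ∣ ≤ n
  wt+zeros≤n [] y h = z≤n
  wt+zeros≤n (true ∷ p) y h rewrite dist-suc y (λ _ → 0#) | ⟦⟧-no (¬? (y zero ≟ 0#)) (λ k → k (h zero refl)) =
    ≤-trans (≤-reflexive (+-suc _ _)) (s≤s (wt+zeros≤n p (y ∘ suc) (h ∘ suc)))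
  wt+zeros≤n (false ∷ p) y h rewrite dist-suc y (λ _ → 0#) =
    ≤-trans (≤-reflexive (+-assoc ⟦ ¬? (y zero ≟ 0#) ⟧ _ ∣ p ∣))
      (+-mono-≤ (⟦⟧≤1 (¬? (y zero ≟ 0#))) (wt+zeros≤n p (y ∘ suc) (h ∘ suc)))

  dist-suc-≡ : ∀ {n} {v x : Vector A (suc n)} → v zero ≡ x zero → dist K v x ≡ dist K (v ∘ suc) (x ∘ suc)
  dist-suc-≡ {v = v} {x} h = trans (dist-suc v x) (cong (_+ dist K (v ∘ suc) (x ∘ suc)) (⟦⟧-no (¬? (v zero ≟ x zero)) (λ k → k h)))

  dist-suc-≢ : ∀ {n} {v x : Vector A (suc n)} → v zero ≢ x zero → dist K v x ≡ suc (dist K (v ∘ suc) (x ∘ suc))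
  dist-suc-≢ {v = v} {x} h = trans (dist-suc v x) (cong (_+ dist K (v ∘ suc) (x ∘ suc)) (⟦⟧-yes (¬? (v zero ≟ x zero)) h))

  -- The vectors agree outside `p` exactly when `p` contains all their differing coordinates, so the
  -- sum counts the supersets of one set of size `dist K v x`. These numbers become the coefficients
  -- of the `B` in the packing identity.
  ∑-agree : ∀ n t (v x : Vector A n) →
    ∑ (subsets n t) (λ p → ⟦ agree? p v x ⟧) ≡ supersets (dist K v x) (n ∸ dist K v x) t
  ∑-agree zero zero v x = refl
  ∑-agree zero (suc t) v x = refl
  ∑-agree (suc n) t v x = cases (v zero ≟ x zero)
    where
    v′ = v ∘ suc
    x′ = x ∘ suc
    d = dist K v′ x′
    f : Subset (suc n) → ℕ
    f p = ⟦ agree? p v x ⟧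
    true-row : ∀ t → ∑ (subsets n t) (λ p → f (true ∷ p)) ≡ supersets d (n ∸ d) t
    true-row t = trans (∑-cong (subsets n t) (λ p → ⟦⟧-cong (agree? (true ∷ p) v x) (agree? p v′ x′)
      (λ h → h ∘ suc) (λ { h (suc i) → h i }))) (∑-agree n t v′ x′)
    false-row-≡ : v zero ≡ x zero → ∀ t → ∑ (subsets n t) (λ p → f (false ∷ p)) ≡ supersets d (n ∸ d) t
    false-row-≡ v≡x t = trans (∑-cong (subsets n t) (λ p → ⟦⟧-cong (agree? (false ∷ p) v x) (agree? p v′ x′)
      (λ h → h ∘ suc) (λ { h zero _ → v≡x ; h (suc i) → h i }))) (∑-agree n t v′ x′)
    false-row-≢ : v zero ≢ x zero → ∀ t → ∑ (subsets n t) (λ p → f (false ∷ p)) ≡ 0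
    false-row-≢ v≢x t = ∑-zero (subsets n t) (λ p → ⟦⟧-no (agree? (false ∷ p) v x) (λ h → v≢x (h zero refl)))
    supersets-zero : ∀ j z → supersets j z 0 ≡ supersets j (suc z) 0
    supersets-zero zero z = refl
    supersets-zero (suc j) z = refl
    step-≡ : v zero ≡ x zero → ∀ t → ∑ (subsets (suc n) t) f ≡ supersets d (suc (n ∸ d)) t
    step-≡ v≡x zero = trans (∑-map (false ∷_) (subsets n 0) f) (trans (false-row-≡ v≡x 0) (supersets-zero d (n ∸ d)))
    step-≡ v≡x (suc t) = trans (∑-subsets n t f)
      (trans (cong₂ _+_ (true-row t) (false-row-≡ v≡x (suc t))) (sym (supersets-pascal d (n ∸ d) t)))
    step-≢ : v zero ≢ x zero → ∀ t → ∑ (subsets (suc n) t) f ≡ supersets (suc d) (n ∸ d) t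
    step-≢ v≢x zero = trans (∑-map (false ∷_) (subsets n 0) f) (false-row-≢ v≢x 0)
    step-≢ v≢x (suc t) = trans (∑-subsets n t f)
      (trans (cong₂ _+_ (true-row t) (false-row-≢ v≢x (suc t))) (+-identityʳ _))
    cases : Dec (v zero ≡ x zero) → ∑ (subsets (suc n) t) f ≡ supersets (dist K v x) (suc n ∸ dist K v x) t
    cases (yes v≡x) = trans (step-≡ v≡x t) (sym (cong₂ (λ j z → supersets j z t) (dist-suc-≡ {v = v} {x} v≡x)
      (trans (cong (suc n ∸_) (dist-suc-≡ {v = v} {x} v≡x)) (+-∸-assoc 1 (dist≤n v′ x′)))))
    cases (no v≢x) = trans (step-≢ v≢x t) (sym (cong (λ j → supersets j (suc n ∸ j) t) (dist-suc-≢ {v = v} {x} v≢x)))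

  length-elements : length (elements K) ≡ size K
  length-elements = trans (length-map from (allFin (size K))) (length-tabulate {n = size K} id)

  ∑-elements-≟ : ∀ b (g : A → ℕ) → ∑ (elements K) (λ a → ⟦ a ≟ b ⟧ * g a) ≡ g b
  ∑-elements-≟ b g = begin
    ∑ (elements K) (λ a → ⟦ a ≟ b ⟧ * g a)                       ≡⟨ ∑-map from (allFin (size K)) _ ⟩
    ∑ (allFin (size K)) (λ i → ⟦ from i ≟ b ⟧ * g (from i))      ≡⟨ ∑-cong (allFin (size K)) (λ i → cong (_* g (from i)) (⟦⟧-cong (from i ≟ b) (i Fin.≟ to b)
                                                                       (λ h → trans (sym (strictlyInverseˡ i)) (cong to h))
                                                                       (λ h → trans (cong from h) (strictlyInverseʳ b)))) ⟩
    ∑ (allFin (size K)) (λ i → ⟦ i Fin.≟ to b ⟧ * g (from i))    ≡⟨ ∑-allFin-≟ (to b) (g ∘ from) ⟩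
    g (from (to b))                                              ≡⟨ cong g (strictlyInverseʳ b) ⟩
    g b                                                          ∎
    where open ≡-Reasoning

  ∑-vectors-≗ : ∀ {n} (y : Vector A n) → ∑ (allVectors K n) (λ x → ⟦ ≗? x y ⟧) ≡ 1
  ∑-vectors-≗ {zero} y = refl
  ∑-vectors-≗ {suc n} y = begin
    ∑ (allVectors K (suc n)) (λ x → ⟦ ≗? x y ⟧)
      ≡⟨ ∑-concatMap (λ a → map (λ v → a ∷ᵥ v) (allVectors K n)) (elements K) _ ⟩
    ∑ (elements K) (λ a → ∑ (map (λ v → a ∷ᵥ v) (allVectors K n)) (λ x → ⟦ ≗? x y ⟧))
      ≡⟨ ∑-cong (elements K) (λ a → trans (∑-map (λ v → a ∷ᵥ v) (allVectors K n) _) (fibre a)) ⟩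
    ∑ (elements K) (λ a → ⟦ a ≟ y zero ⟧ * 1)
      ≡⟨ ∑-elements-≟ (y zero) (λ _ → 1) ⟩
    1 ∎
    where
    open ≡-Reasoning
    fibre : ∀ a → ∑ (allVectors K n) (λ v → ⟦ ≗? (a ∷ᵥ v) y ⟧) ≡ ⟦ a ≟ y zero ⟧ * 1
    fibre a = trans (∑-cong (allVectors K n) (λ v → trans
        (⟦⟧-cong (≗? (a ∷ᵥ v) y) ((a ≟ y zero) ×-dec ≗? v (y ∘ suc))
          (λ h → h zero , h ∘ suc) (λ { (h , k) zero → h ; (h , k) (suc i) → k i }))
        (⟦⟧-× (a ≟ y zero) (≗? v (y ∘ suc)))))
      (trans (∑-*ˡ (allVectors K n) ⟦ a ≟ y zero ⟧ _) (cong (⟦ a ≟ y zero ⟧ *_) (∑-vectors-≗ (y ∘ suc))))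

  ∑-vectors≤1 : ∀ {n} {P : Vector A n → Set} (P? : Decidable P) → (∀ {x y} → P x → P y → x ≗ y) →
    ∑ (allVectors K n) (λ x → ⟦ P? x ⟧) ≤ 1
  ∑-vectors≤1 {n} P? unique with ∑ (allVectors K n) (λ x → ⟦ P? x ⟧) ℕ.≟ 0
  ... | yes eq = ≤-trans (≤-reflexive eq) z≤n
  ... | no neq with ∑≢0 (allVectors K n) neq
  ... | y , Py = ≤-trans (∑-mono (allVectors K n) (λ x → ⟦⟧-mono (P? x) (≗? x y) (λ Px → unique Px (⟦⟧≢0 (P? y) Py))))
    (≤-reflexive (∑-vectors-≗ y))

  -- Without function extensionality y occurs in allVectors only up to ≗.
  1≤∑-vectors : ∀ {n} {P : Vector A n → Set} (P? : Decidable P) y → (∀ {x} → x ≗ y → P x) →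
    1 ≤ ∑ (allVectors K n) (λ x → ⟦ P? x ⟧)
  1≤∑-vectors {n} P? y h = ≤-trans (≤-reflexive (sym (∑-vectors-≗ y)))
    (∑-mono (allVectors K n) (λ x → ⟦⟧-mono (≗? x y) (P? x) h))

-- Syndromes, and codewords agreeing with a vector outside a set of coordinates

module CodeLemmas (K : FiniteField) {r n : ℕ} (H : Matrix K r n) where
  open FieldLemmas K public

  syn : Vector A n → Vector A r
  syn x j = sumK K (λ i → H j i ⊗ x i)

  row : Vector A r → Vector A n
  row c i = sumK K (λ j → c j ⊗ H j i)

  syn-axpy : ∀ a x y j → syn (λ i → a ⊗ x i ⊕ y i) j ≡ a ⊗ syn x j ⊕ syn y j
  syn-axpy a x y j = dot-⊕ (H j) x y a

  dot-syn : ∀ c x → sumK K (λ j → c j ⊗ syn x j) ≡ sumK K (λ i → row c i ⊗ x i)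
  dot-syn c x = begin
    sumK K (λ j → c j ⊗ syn x j)                        ≡⟨ sumK-cong (λ j → sym (sumK-⊗ˡ (c j) (λ i → H j i ⊗ x i))) ⟩
    sumK K (λ j → sumK K (λ i → c j ⊗ (H j i ⊗ x i)))   ≡⟨ sumK-swap (λ j i → c j ⊗ (H j i ⊗ x i)) ⟩
    sumK K (λ i → sumK K (λ j → c j ⊗ (H j i ⊗ x i)))   ≡⟨ sumK-cong (λ i → trans (sumK-cong (λ j → sym (R.*-assoc (c j) (H j i) (x i))))
                                                                              (sumK-⊗ʳ (λ j → c j ⊗ H j i) (x i))) ⟩
    sumK K (λ i → row c i ⊗ x i)                        ∎
    where open ≡-Reasoning

  codeword-cong : ∀ {x y} → x ≗ y → InCode K H x → InCode K H y
  codeword-cong x≗y h j = trans (sumK-cong (λ i → cong (H j i ⊗_) (sym (x≗y i)))) (h j)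

  codeword-axpy : ∀ {x y} a → InCode K H x → InCode K H y → InCode K H (λ i → a ⊗ x i ⊕ y i)
  codeword-axpy {x} {y} a hx hy j = trans (syn-axpy a x y j)
    (trans (cong₂ (λ u v → a ⊗ u ⊕ v) (hx j) (hy j)) (trans (R.+-identityʳ _) (R.zeroʳ a)))

  -- Linear independence of the columns of `H` in `p`: a codeword supported on `p` is a linear
  -- relation between them.
  IndependentOn : Subset n → Set
  IndependentOn p = ∀ x → InCode K H x → Supported p x → IsZero K x

  -- The vector `s` and the r columns in `p` are r + 1 vectors in a space of dimension r, hence
  -- related. Independence forces a nonzero coefficient at `s`, and dividing by it solves for `s`.
  syn-surjective-on : ∀ p → IndependentOn p → ∣ p ∣ ≡ r → ∀ s → ∃ λ e → Supported p e × syn e ≗ s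
  syn-surjective-on p independent refl s
    with nontrivial-solution (λ j → s j ∷ᵥ (λ l → H j (pos p l))) ≤-refl
  ... | w , w-sol , w≢0 with w zero ≟ 0#
  ... | yes w₀≡0 = ⊥-elim (w≢0 λ { zero → w₀≡0 ; (suc l) → trans (sym (spread-pos p w′ l)) (zero-spread (pos p l)) })
    where
    w′ = w ∘ suc
    zero-spread : IsZero K (spread p w′)
    zero-spread = independent (spread p w′)
      (λ j → trans (sumK-spread p (H j) w′) (trans (sym (R.+-identityˡ _))
        (trans (cong (_⊕ sumK K (λ l → H j (pos p l) ⊗ w′ l)) (sym (trans (cong (s j ⊗_) w₀≡0) (R.zeroʳ (s j))))) (w-sol j))))
      (spread-outside p w′)
  ... | no w₀≢0 with inverse (w zero) w₀≢0
  ... | u , w₀u≡1 = e , (λ i h → trans (cong (⊖ u ⊗_) (spread-outside p w′ i h)) (R.zeroʳ _)) , λ j → begin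
      syn e j                                     ≡⟨ sumK-cong (λ i → commute (H j i) (spread p w′ i)) ⟩
      sumK K (λ i → ⊖ u ⊗ (H j i ⊗ spread p w′ i)) ≡⟨ sumK-⊗ˡ (⊖ u) (λ i → H j i ⊗ spread p w′ i) ⟩
      ⊖ u ⊗ syn (spread p w′) j                   ≡⟨ cong (⊖ u ⊗_) (trans (sumK-spread p (H j) w′) (solved j)) ⟩
      ⊖ u ⊗ ⊖ (s j ⊗ w zero)                      ≡⟨ RP.-‿distribˡ-* u _ ⟨
      ⊖ (u ⊗ ⊖ (s j ⊗ w zero))                    ≡⟨ cong ⊖_ (RP.-‿distribʳ-* u _) ⟨
      ⊖ (⊖ (u ⊗ (s j ⊗ w zero)))                  ≡⟨ RP.-‿involutive (u ⊗ (s j ⊗ w zero)) ⟩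
      u ⊗ (s j ⊗ w zero)                          ≡⟨ R.*-comm u _ ⟩
      s j ⊗ w zero ⊗ u                            ≡⟨ R.*-assoc (s j) (w zero) u ⟩
      s j ⊗ (w zero ⊗ u)                          ≡⟨ cong (s j ⊗_) w₀u≡1 ⟩
      s j ⊗ 1#                                    ≡⟨ R.*-identityʳ (s j) ⟩
      s j                                         ∎
    where
    open ≡-Reasoning
    w′ = w ∘ suc
    e : Vector A n
    e i = ⊖ u ⊗ spread p w′ i
    commute : ∀ a b → a ⊗ (⊖ u ⊗ b) ≡ ⊖ u ⊗ (a ⊗ b)
    commute a b = trans (sym (R.*-assoc a (⊖ u) b)) (trans (cong (_⊗ b) (R.*-comm a (⊖ u))) (R.*-assoc (⊖ u) a b))
    solved : ∀ j → sumK K (λ l → H j (pos p l) ⊗ w′ l) ≡ ⊖ (s j ⊗ w zero)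
    solved j = RP.+-inverseʳ-unique _ _ (w-sol j)

  -- Fewer than r columns lie in a hyperplane, and `c` is a normal vector of it: r unknowns against
  -- one equation for each column.
  annihilator : ∀ p → ∣ p ∣ < r → ∃ λ c → ¬ IsZero K c × (∀ i → lookup p i ≡ true → row c i ≡ 0#)
  annihilator p p<r with nontrivial-solution (λ l j → H j (pos p l)) p<r
  ... | c , c-sol , c≢0 = c , c≢0 , vanish
    where
    vanish : ∀ i → lookup p i ≡ true → row c i ≡ 0#
    vanish i h with pos-surjective p h
    ... | l , refl = trans (sumK-cong (λ j → R.*-comm (c j) _)) (c-sol l)

  Agreeing : Subset n → Vector A n → Vector A n → Set
  Agreeing p v x = InCode K H x × Agree p v x

  agreeing? : ∀ p v x → Dec (Agreeing p v x)
  agreeing? p v x = inCode? K H x ×-dec agree? p v x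

  -- The N_p(v) of the overview.
  #agreeing : Subset n → Vector A n → ℕ
  #agreeing p v = ∑ (allVectors K n) (λ x → ⟦ agreeing? p v x ⟧)

  agreeing-unique : ∀ p v {x y} → IndependentOn p → Agreeing p v x → Agreeing p v y → x ≗ y
  agreeing-unique p v independent (hx , ax) (hy , ay) i =
    -1x+y≡0⇒x≡y (independent _ (codeword-axpy (⊖ 1#) hx hy) (λ i h →
      trans (cong₂ (λ a b → ⊖ 1# ⊗ a ⊕ b) (sym (ax i h)) (sym (ay i h))) (-1x+x≡0 (v i))) i)

  #agreeing≤1 : ∀ p v → IndependentOn p → #agreeing p v ≤ 1
  #agreeing≤1 p v independent = ∑-vectors≤1 (agreeing? p v) (agreeing-unique p v independent)

  1≤#agreeing : ∀ p v {x} → Agreeing p v x → 1 ≤ #agreeing p v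
  1≤#agreeing p v {x} (hx , ax) = 1≤∑-vectors (agreeing? p v) x
    (λ y≗x → codeword-cong (sym ∘ y≗x) hx , λ i h → trans (ax i h) (sym (y≗x i)))

  -- Some error vector `e` on `p` has the syndrome of `v`; the codeword is `v` minus `e`.
  agreeing-exists : ∀ p → IndependentOn p → ∣ p ∣ ≡ r → ∀ v → ∃ λ x → Agreeing p v x
  agreeing-exists p independent ∣p∣≡r v with syn-surjective-on p independent ∣p∣≡r (syn v)
  ... | e , supp , eq = (λ i → ⊖ 1# ⊗ e i ⊕ v i)
    , (λ j → trans (syn-axpy (⊖ 1#) e v j) (trans (cong (λ a → ⊖ 1# ⊗ a ⊕ syn v j) (eq j)) (-1x+x≡0 _)))
    , λ i h → sym (trans (cong (λ a → ⊖ 1# ⊗ a ⊕ v i) (supp i h)) (trans (cong (_⊕ v i) (R.zeroʳ _)) (R.+-identityˡ _)))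

  #agreeing≡1 : ∀ p → IndependentOn p → ∣ p ∣ ≡ r → ∀ v → #agreeing p v ≡ 1
  #agreeing≡1 p independent ∣p∣≡r v =
    ≤-antisym (#agreeing≤1 p v independent) (1≤#agreeing p v (proj₂ (agreeing-exists p independent ∣p∣≡r v)))

  agree-insert : ∀ (p : Subset n) i a {v x : Vector A n} → Agree p (updateAt v i (const a)) x → Agree (p [ i ]≔ true) v x
  agree-insert p i a {v} {x} h j out with false∉insert p out
  ... | j≢i , pj = trans (sym (updateAt-minimal j i {const a} v j≢i)) (h j pj)

  -- The codewords are sorted by their entry `a` at `i`: prescribing it amounts to writing `a` into
  -- `v` and asking for agreement at `i` too.
  #agreeing-insert : ∀ p i v → lookup p i ≡ false →
    #agreeing (p [ i ]≔ true) v ≡ ∑ (elements K) (λ a → #agreeing p (updateAt v i (const a)))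
  #agreeing-insert p i v i∉p = sym (begin
    ∑ (elements K) (λ a → ∑ (allVectors K n) (λ x → ⟦ agreeing? p (v′ a) x ⟧))
      ≡⟨ ∑-swap (elements K) (allVectors K n) _ ⟩
    ∑ (allVectors K n) (λ x → ∑ (elements K) (λ a → ⟦ agreeing? p (v′ a) x ⟧))
      ≡⟨ ∑-cong (allVectors K n) (λ x → trans (∑-cong (elements K) (pointwise x))
           (∑-elements-≟ (x i) (λ _ → ⟦ agreeing? (p [ i ]≔ true) v x ⟧))) ⟩
    ∑ (allVectors K n) (λ x → ⟦ agreeing? (p [ i ]≔ true) v x ⟧) ∎)
    where
    open ≡-Reasoning
    v′ : A → Vector A n
    v′ a = updateAt v i (const a)
    pointwise : ∀ x a → ⟦ agreeing? p (v′ a) x ⟧ ≡ ⟦ a ≟ x i ⟧ * ⟦ agreeing? (p [ i ]≔ true) v x ⟧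
    pointwise x a = trans (⟦⟧-cong (agreeing? p (v′ a) x) ((a ≟ x i) ×-dec agreeing? (p [ i ]≔ true) v x)
        (λ (hx , ax) → trans (sym (updateAt-updates i v)) (ax i i∉p) , hx , agree-insert p i a {v} {x} ax)
        (λ (a≡xᵢ , hx , ax) → hx , backward a≡xᵢ ax))
      (⟦⟧-× (a ≟ x i) (agreeing? (p [ i ]≔ true) v x))
      where
      backward : a ≡ x i → Agree (p [ i ]≔ true) v x → Agree p (v′ a) x
      backward a≡xᵢ ax j pj with j Fin.≟ i
      ... | yes refl = trans (updateAt-updates i v) a≡xᵢ
      ... | no j≢i = trans (updateAt-minimal j i v j≢i) (ax j (trans (lookup-insert-other p j≢i) pj))

  -- When the columns in p are independent: column i of H lies in their span.
  Completes : Subset n → Fin n → Set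
  Completes p i = lookup p i ≡ false × ∃ λ z → InCode K H z × Supported (p [ i ]≔ true) z × z i ≢ 0#

  agreeing-shift : ∀ p i v w {x} → Completes p i → Agree (p [ i ]≔ true) v w → Agreeing p v x → ∃ λ y → Agreeing p w y
  agreeing-shift p i v w {x} (i∉p , z , hz , sz , zᵢ≢0) vw (hx , ax) with inverse (z i) zᵢ≢0
  ... | u , zᵢu≡1 = (λ j → a ⊗ z j ⊕ x j) , codeword-axpy a hz hx , agree
    where
    -- The multiple of `z` that changes the entry at `i` from `x i` to `w i`. Outside `p` and `i`
    -- the word `z` vanishes, so nothing else that is compared moves.
    a = (w i ⊕ ⊖ x i) ⊗ u
    agree : Agree p w (λ j → a ⊗ z j ⊕ x j)
    agree j pj with j Fin.≟ i
    ... | no j≢i = sym (trans (cong (λ b → a ⊗ b ⊕ x j) (sz j out)) (trans (cong (_⊕ x j) (R.zeroʳ a))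
            (trans (R.+-identityˡ _) (trans (sym (ax j pj)) (vw j out)))))
      where
      out = trans (lookup-insert-other p j≢i) pj
    ... | yes refl = sym (begin
      (w i ⊕ ⊖ x i) ⊗ u ⊗ z i ⊕ x i     ≡⟨ cong (_⊕ x i) (R.*-assoc _ u (z i)) ⟩
      (w i ⊕ ⊖ x i) ⊗ (u ⊗ z i) ⊕ x i   ≡⟨ cong (λ b → (w i ⊕ ⊖ x i) ⊗ b ⊕ x i) (trans (R.*-comm u (z i)) zᵢu≡1) ⟩
      (w i ⊕ ⊖ x i) ⊗ 1# ⊕ x i          ≡⟨ cong (_⊕ x i) (R.*-identityʳ _) ⟩
      w i ⊕ ⊖ x i ⊕ x i                 ≡⟨ R.+-assoc _ _ _ ⟩
      w i ⊕ (⊖ x i ⊕ x i)               ≡⟨ cong (w i ⊕_) (R.-‿inverseˡ (x i)) ⟩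
      w i ⊕ 0#                          ≡⟨ R.+-identityʳ _ ⟩
      w i                               ∎)
      where open ≡-Reasoning

  #agreeing-shift-≤ : ∀ p i v w → IndependentOn p → Completes p i → Agree (p [ i ]≔ true) v w →
    #agreeing p v ≤ #agreeing p w
  #agreeing-shift-≤ p i v w independent completes vw with #agreeing p v ℕ.≟ 0
  ... | yes eq = ≤-trans (≤-reflexive eq) z≤n
  ... | no neq with ∑≢0 (allVectors K n) neq
  ... | x , hx = ≤-trans (#agreeing≤1 p v independent)
    (1≤#agreeing p w (proj₂ (agreeing-shift p i v w completes vw (⟦⟧≢0 (agreeing? p v x) hx))))

  -- By `agreeing-shift`, applied in both directions, the count for `p` does not depend on the entry
  -- of `v` at `i`; the terms of `#agreeing-insert` are therefore all equal.
  #agreeing-completed : ∀ p i v → IndependentOn p → Completes p i →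
    #agreeing (p [ i ]≔ true) v ≡ size K * #agreeing p v
  #agreeing-completed p i v independent completes = begin
    #agreeing (p [ i ]≔ true) v                                         ≡⟨ #agreeing-insert p i v (proj₁ completes) ⟩
    ∑ (elements K) (λ a → #agreeing p (updateAt v i (const a)))         ≡⟨ ∑-cong (elements K) (λ a → ≤-antisym
                                                                             (#agreeing-shift-≤ p i (v′ a) v independent completes (near a))
                                                                             (#agreeing-shift-≤ p i v (v′ a) independent completes (λ j h → sym (near a j h)))) ⟩
    ∑ (elements K) (λ _ → #agreeing p v)                                ≡⟨ ∑-const (elements K) _ ⟩
    length (elements K) * #agreeing p v                                 ≡⟨ cong (_* #agreeing p v) length-elements ⟩
    size K * #agreeing p v                                              ∎
    where
    open ≡-Reasoning
    v′ : A → Vector A n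
    v′ a = updateAt v i (const a)
    near : ∀ a → Agree (p [ i ]≔ true) (v′ a) v
    near a j h = updateAt-minimal j i v (proj₁ (false∉insert p h))

-- Near-MDS codes and the Steiner system of minimum supports

IsNearMDS : (K : FiniteField) (k r : ℕ) {n : ℕ} → Matrix K r n → Set
IsNearMDS K k r H = FullRank K H × HasMinDist K (InCode K H) r × HasMinDist K (InDual K H) k

module NearMDSLemmas (K : FiniteField) {k t n : ℕ} (H : Matrix K (suc t) n) (k+r≡n : k + suc t ≡ n)
  (nmds : IsNearMDS K k (suc t) H) where
  open CodeLemmas K H public

  fullRank : FullRank K H
  fullRank = proj₁ nmds

  minDist : ∀ x → InCode K H x → ¬ IsZero K x → suc t ≤ wt K x
  minDist = proj₁ (proj₁ (proj₂ nmds))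

  dualDist : ∀ y → InDual K H y → ¬ IsZero K y → k ≤ wt K y
  dualDist = proj₁ (proj₂ (proj₂ nmds))

  zero? : ∀ {m} (x : Vector A m) → Dec (IsZero K x)
  zero? x = ≗? x (λ _ → 0#)

  wt-zero : ∀ {x : Vector A n} → IsZero K x → wt K x ≡ 0
  wt-zero {x} h = n≤0⇒n≡0 (≤-trans (dist≤∣∣ ∅ {x} {λ _ → 0#} (λ i _ → h i)) (≤-reflexive (∣⊥∣≡0 n)))

  wt≡0⇒IsZero : ∀ {x : Vector A n} → wt K x ≡ 0 → IsZero K x
  wt≡0⇒IsZero {x} h i with dist-subset x (λ _ → 0#) (≤-reflexive h) z≤n
  ... | p , ∣p∣≡0 , agree with outside? p i
  ...   | yes out = agree i out
  ...   | no in′ with pos-surjective p {i} (¬-not in′)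
  ...     | l , _ with subst Fin ∣p∣≡0 l
  ...       | ()

  1≤k : 1 ≤ k
  1≤k with proj₂ (proj₂ (proj₂ nmds))
  ... | y , _ , y≢0 , wt≡k = n≢0⇒n>0 (λ k≡0 → y≢0 (wt≡0⇒IsZero {y} (trans wt≡k k≡0)))

  r<n : suc t < n
  r<n = ≤-trans (+-monoˡ-≤ (suc t) 1≤k) (≤-reflexive k+r≡n)

  independent-small : ∀ p → ∣ p ∣ ≤ t → IndependentOn p
  independent-small p p≤t x hx sx = decidable-stable (zero? x)
    (λ x≢0 → <-irrefl refl (≤-trans (minDist x hx x≢0) (≤-trans (dist≤∣∣ p {x} {λ _ → 0#} sx) p≤t)))

  -- Full rank makes `row c` a nonzero dual word; its weight is at least k, which leaves at most n -
  -- k zeros.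
  row-zeros : ∀ c p → ¬ IsZero K c → (∀ i → lookup p i ≡ true → row c i ≡ 0#) → ∣ p ∣ ≤ suc t
  row-zeros c p c≢0 h = +-cancelˡ-≤ k _ _ (≤-trans
    (+-monoˡ-≤ ∣ p ∣ (dualDist (row c) (c , λ _ → refl) (λ row≡0 → c≢0 (fullRank c row≡0))))
    (≤-trans (wt+zeros≤n p (row c) h) (≤-reflexive (sym k+r≡n))))

  -- A dual word is orthogonal to the codeword `z`. In the inner product the terms on `p` vanish
  -- through `row c` and those outside `p` and `i` through `z`, so the term at `i` vanishes as well.
  row-completed : ∀ c p i → (∀ j → lookup p j ≡ true → row c j ≡ 0#) → Completes p i → row c i ≡ 0#
  row-completed c p i vanish (i∉p , z , hz , sz , zᵢ≢0) = integral zᵢ≢0 (begin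
    z i ⊗ row c i                          ≡⟨ R.*-comm _ _ ⟩
    row c i ⊗ z i                          ≡⟨ sumK-single i others ⟨
    sumK K (λ l → row c l ⊗ z l)           ≡⟨ dot-syn c z ⟨
    sumK K (λ j → c j ⊗ syn z j)           ≡⟨ sumK-zero (λ j → trans (cong (c j ⊗_) (hz j)) (R.zeroʳ (c j))) ⟩
    0#                                     ∎)
    where
    open ≡-Reasoning
    others : ∀ j → j ≢ i → row c j ⊗ z j ≡ 0#
    others j j≢i with lookup p j in eq
    ... | true = trans (cong (_⊗ z j) (vanish j eq)) (R.zeroˡ _)
    ... | false = trans (cong (row c j ⊗_) (sz j (trans (lookup-insert-other p j≢i) eq))) (R.zeroʳ _)

  vanish-insert : ∀ c p i → (∀ j → lookup p j ≡ true → row c j ≡ 0#) → row c i ≡ 0# →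
    ∀ j → lookup (p [ i ]≔ true) j ≡ true → row c j ≡ 0#
  vanish-insert c p i vanish cᵢ≡0 j h with j Fin.≟ i
  ... | yes refl = cᵢ≡0
  ... | no j≢i = vanish j (trans (sym (lookup-insert-other p j≢i)) h)

  -- On `p` and `i` the word `row c` already has t + 1 zeros, all that `row-zeros` permits; `j`
  -- would be one too many.
  row-uncompleted : ∀ c p i j → ¬ IsZero K c → (∀ l → lookup p l ≡ true → row c l ≡ 0#) → ∣ p ∣ ≡ t →
    Completes p i → lookup p j ≡ false → j ≢ i → row c j ≢ 0#
  row-uncompleted c p i j c≢0 vanish ∣p∣≡t completes j∉p j≢i cⱼ≡0 = <-irrefl refl (≤-trans
    (≤-reflexive (sym (trans (∣∣-insert (p [ i ]≔ true) j (trans (lookup-insert-other p j≢i) j∉p))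
      (cong suc (trans (∣∣-insert p i (proj₁ completes)) (cong suc ∣p∣≡t))))))
    (row-zeros c (p [ i ]≔ true [ j ]≔ true) c≢0
      (vanish-insert c (p [ i ]≔ true) j (vanish-insert c p i vanish (row-completed c p i vanish completes)) cⱼ≡0)))

  -- A normal vector of the span of `p` vanishes at every completing point, and there is room for
  -- only one zero beyond `p`. Thus a t-set lies in at most one block.
  completes-unique : ∀ p → ∣ p ∣ ≡ t → ∀ i j → Completes p i → Completes p j → i ≡ j
  completes-unique p ∣p∣≡t i j ci cj with annihilator p (s≤s (≤-reflexive ∣p∣≡t))
  ... | c , c≢0 , vanish = decidable-stable (i Fin.≟ j) (λ i≢j →
    row-uncompleted c p i j c≢0 vanish ∣p∣≡t ci (proj₁ cj) (i≢j ∘ sym) (row-completed c p j vanish cj))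

  supported-shrink : ∀ p i {x : Vector A n} → Supported (p [ i ]≔ true) x → x i ≡ 0# → Supported p x
  supported-shrink p i sx xᵢ≡0 j out with j Fin.≟ i
  ... | yes refl = xᵢ≡0
  ... | no j≢i = sx j (trans (lookup-insert-other p j≢i) out)

  nonzero-completes : ∀ p i x → ∣ p ∣ ≡ t → lookup p i ≡ false →
    InCode K H x → Supported (p [ i ]≔ true) x → ¬ IsZero K x → Completes p i
  nonzero-completes p i x ∣p∣≡t i∉p hx sx x≢0 = i∉p , x , hx , sx , λ xᵢ≡0 →
    x≢0 (independent-small p (≤-reflexive ∣p∣≡t) x hx (supported-shrink p i sx xᵢ≡0))

  -- A relation on `p` and `j` would make `j` a second point completing `p`.
  independent-insert : ∀ p i j → ∣ p ∣ ≡ t → Completes p i → lookup p j ≡ false → j ≢ i → IndependentOn (p [ j ]≔ true)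
  independent-insert p i j ∣p∣≡t completes j∉p j≢i x hx sx = decidable-stable (zero? x) (λ x≢0 →
    j≢i (completes-unique p ∣p∣≡t j i (nonzero-completes p j x ∣p∣≡t j∉p hx sx x≢0) completes))

  -- The padding of `dist-subset`, applied to a vector and itself.
  subset-of-size : ∀ {s} → s ≤ n → ∃ λ (p : Subset n) → ∣ p ∣ ≡ s
  subset-of-size s≤n with dist-subset (λ _ → 0#) (λ _ → 0#) (≤-trans (≤-reflexive (wt-zero {λ _ → 0#} (λ _ → refl))) z≤n) s≤n
  ... | p , ∣p∣≡s , _ = p , ∣p∣≡s

  Nonzero : Subset n → Vector A n → Set
  Nonzero p x = InCode K H x × Supported p x × ¬ IsZero K x

  nonzero? : ∀ p x → Dec (Nonzero p x)
  nonzero? p x = inCode? K H x ×-dec (agree? p x (λ _ → 0#) ×-dec ¬? (zero? x))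

  #nonzero : Subset n → ℕ
  #nonzero p = ∑ (allVectors K n) (λ x → ⟦ nonzero? p x ⟧)

  -- A codeword supported on `p` and `i` is determined by its entry at `i`, because the columns in
  -- `p` are independent. This allows at most |K| codewords, one of which is zero.
  1+#nonzero≤size : ∀ p i → ∣ p ∣ ≡ t → lookup p i ≡ false → suc (#nonzero (p [ i ]≔ true)) ≤ size K
  1+#nonzero≤size p i ∣p∣≡t i∉p = begin
    suc (#nonzero q)                                              ≡⟨ +-comm 1 _ ⟩
    #nonzero q + 1                                                ≡⟨ cong (#nonzero q +_) (∑-vectors-≗ {n} (λ _ → 0#)) ⟨
    #nonzero q + ∑ (allVectors K n) (λ x → ⟦ zero? x ⟧)           ≡⟨ ∑-+ (allVectors K n) _ _ ⟨
    ∑ (allVectors K n) (λ x → ⟦ nonzero? q x ⟧ + ⟦ zero? x ⟧)     ≤⟨ ∑-mono (allVectors K n) pointwise ⟩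
    #agreeing q (λ _ → 0#)                                        ≡⟨ #agreeing-insert p i (λ _ → 0#) i∉p ⟩
    ∑ (elements K) (λ a → #agreeing p (updateAt (λ _ → 0#) i (const a)))
      ≤⟨ ∑-mono (elements K) (λ a → #agreeing≤1 p _ (independent-small p (≤-reflexive ∣p∣≡t))) ⟩
    ∑ (elements K) (λ _ → 1)                                      ≡⟨ length≡∑1 (elements K) ⟨
    length (elements K)                                           ≡⟨ length-elements ⟩
    size K                                                        ∎
    where
    open ≤-Reasoning
    q = p [ i ]≔ true
    pointwise : ∀ x → ⟦ nonzero? q x ⟧ + ⟦ zero? x ⟧ ≤ ⟦ agreeing? q (λ _ → 0#) x ⟧
    pointwise x = cases (zero? x)
      where
      cases : Dec (IsZero K x) → ⟦ nonzero? q x ⟧ + ⟦ zero? x ⟧ ≤ ⟦ agreeing? q (λ _ → 0#) x ⟧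
      cases (yes x≡0) = ≤-trans (≤-reflexive (cong₂ _+_ (⟦⟧-no (nonzero? q x) (λ (_ , _ , x≢0) → x≢0 x≡0)) refl))
        (⟦⟧-mono (zero? x) (agreeing? q (λ _ → 0#) x) (λ _ →
          (λ j → sumK-zero (λ l → trans (cong (H j l ⊗_) (x≡0 l)) (R.zeroʳ _))) , λ l _ → sym (x≡0 l)))
      cases (no x≢0) = ≤-trans (≤-reflexive (trans (cong (⟦ nonzero? q x ⟧ +_) (⟦⟧-no (zero? x) x≢0)) (+-identityʳ _)))
        (⟦⟧-mono (nonzero? q x) (agreeing? q (λ _ → 0#) x) (λ (hx , sx , _) → hx , λ l out → sym (sx l out)))

  A≤∑#nonzero : A[_] K (suc t) H ≤ ∑ (subsets n (suc t)) #nonzero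
  A≤∑#nonzero = begin
    A[_] K (suc t) H
      ≡⟨ length-filter≡∑ (λ x → inCode? K H x ×-dec (wt K x ℕ.≟ suc t)) (allVectors K n) ⟩
    ∑ (allVectors K n) (λ x → ⟦ inCode? K H x ×-dec (wt K x ℕ.≟ suc t) ⟧)
      ≤⟨ ∑-mono (allVectors K n) (λ x → pointwise x (inCode? K H x ×-dec (wt K x ℕ.≟ suc t))) ⟩
    ∑ (allVectors K n) (λ x → ∑ (subsets n (suc t)) (λ p → ⟦ nonzero? p x ⟧))
      ≡⟨ ∑-swap (allVectors K n) (subsets n (suc t)) _ ⟩
    ∑ (subsets n (suc t)) #nonzero ∎
    where
    open ≤-Reasoning
    pointwise : ∀ x (d : Dec (InCode K H x × wt K x ≡ suc t)) → ⟦ d ⟧ ≤ ∑ (subsets n (suc t)) (λ p → ⟦ nonzero? p x ⟧)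
    pointwise x (no _) = z≤n
    pointwise x (yes (hx , wt≡)) with dist-subset x (λ _ → 0#) (≤-reflexive wt≡) (<⇒≤ r<n)
    ... | p , ∣p∣≡r , sx = ≤-trans (≤-reflexive (sym (⟦⟧-yes (nonzero? p x)
        (hx , sx , λ x≡0 → 1+n≢0 (trans (sym wt≡) (wt-zero {x} x≡0))))))
      (∈⇒≤∑ (λ p → ⟦ nonzero? p x ⟧) (subst (λ s → p ∈ subsets n s) ∣p∣≡r (∈subsets p)))

  -- The supports of the codewords of weight n - k form a Steiner system S(n-k-1, n-k, n): the bound
  -- (n-k) A_{n-k} ≤ C(n,k+1) (q-1) is a sum over the (n-k-1)-subsets p, and equality makes every term attain its maximum.
  steiner : A[_] K (suc t) H * suc t ≡ (n C (k + 1)) * (size K ∸ 1) →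
    ∀ p → ∣ p ∣ ≡ t → ∃ (Completes p)
  steiner count p ∣p∣≡t = proj₁ flag , completes p ∣p∣≡t (proj₁ flag) (proj₂ flag)
    where
    flags : Subset n → ℕ
    flags p = ∑ (allFin n) (λ i → ⟦ outside? p i ⟧ * #nonzero (p [ i ]≔ true))
    completes : ∀ p → ∣ p ∣ ≡ t → ∀ i → ⟦ outside? p i ⟧ * #nonzero (p [ i ]≔ true) ≢ 0 → Completes p i
    completes p ∣p∣≡t i h with ∑≢0 (allVectors K n) {λ x → ⟦ nonzero? (p [ i ]≔ true) x ⟧}
      (λ eq → h (trans (cong (⟦ outside? p i ⟧ *_) eq) (*-zeroʳ ⟦ outside? p i ⟧)))
    ... | x , hx with ⟦⟧≢0 (nonzero? (p [ i ]≔ true) x) hx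
    ... | hx , sx , x≢0 = nonzero-completes p i x ∣p∣≡t
      (⟦⟧≢0 (outside? p i) (λ eq → h (cong (_* #nonzero (p [ i ]≔ true)) eq))) hx sx x≢0
    flags≤ : ∀ p → ∣ p ∣ ≡ t → flags p ≤ size K ∸ 1
    flags≤ p ∣p∣≡t = ∑-allFin-single _ (λ i → bound i (outside? p i))
      (λ i j hi hj → completes-unique p ∣p∣≡t i j (completes p ∣p∣≡t i hi) (completes p ∣p∣≡t j hj))
      where
      bound : ∀ i (d : Dec (lookup p i ≡ false)) → ⟦ d ⟧ * #nonzero (p [ i ]≔ true) ≤ size K ∸ 1
      bound i (no _) = z≤n
      bound i (yes i∉p) = ≤-trans (≤-reflexive (+-identityʳ _)) (∸-monoˡ-≤ 1 (1+#nonzero≤size p i ∣p∣≡t i∉p))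
    -- The binomial of the hypothesis counts t-subsets, through their complements of size k + 1.
    nC[k+1]≡nCt : n C (k + 1) ≡ n C t
    nC[k+1]≡nCt = trans (nCk≡nC[n∸k] (≤-trans (m≤m+n (k + 1) t) (≤-reflexive eq)))
      (cong (n C_) (trans (cong (_∸ (k + 1)) (sym eq)) (m+n∸m≡n (k + 1) t)))
      where
      eq : k + 1 + t ≡ n
      eq = trans (+-assoc k 1 t) k+r≡n
    total : length (subsets n t) * (size K ∸ 1) ≤ ∑ (subsets n t) flags
    total = begin
      length (subsets n t) * (size K ∸ 1)        ≡⟨ cong (_* (size K ∸ 1)) (trans (length-subsets n t) (sym nC[k+1]≡nCt)) ⟩
      (n C (k + 1)) * (size K ∸ 1)               ≡⟨ count ⟨
      A[_] K (suc t) H * suc t                   ≡⟨ *-comm (A[_] K (suc t) H) (suc t) ⟩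
      suc t * A[_] K (suc t) H                   ≤⟨ *-monoʳ-≤ (suc t) A≤∑#nonzero ⟩
      suc t * ∑ (subsets n (suc t)) #nonzero     ≡⟨ ∑-flags n t #nonzero ⟩
      ∑ (subsets n t) flags                      ∎
      where open ≤-Reasoning
    tight : flags p ≡ size K ∸ 1
    tight = ∑-tight flags (λ {q} q∈ → flags≤ q (∈subsets⇒∣∣ n t q∈)) total (subst (λ s → p ∈ subsets n s) ∣p∣≡t (∈subsets p))
    size-1≢0 : size K ∸ 1 ≢ 0
    size-1≢0 = m>n⇒m∸n≢0 1<size
    flag : ∃ λ i → ⟦ outside? p i ⟧ * #nonzero (p [ i ]≔ true) ≢ 0
    flag = ∑≢0 (allFin n) (λ flags≡0 → size-1≢0 (trans (sym tight) flags≡0))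

-- From an identity of counts to rational weights

fromℕ : ℕ → ℚ
fromℕ n = ℤ.+ n ℚ./ 1

private
  toℚᵘ-fromℕ : ∀ n → ℚ.toℚᵘ (fromℕ n) ℚᵘ.≃ mkℚᵘ (ℤ.+ n) 0
  toℚᵘ-fromℕ n = ℚₚ.toℚᵘ-fromℚᵘ (mkℚᵘ (ℤ.+ n) 0)

fromℕ-+ : ∀ a b → fromℕ (a + b) ≡ fromℕ a ℚ.+ fromℕ b
fromℕ-+ a b = ℚₚ.toℚᵘ-injective (begin
  ℚ.toℚᵘ (fromℕ (a + b))                    ≈⟨ toℚᵘ-fromℕ (a + b) ⟩
  mkℚᵘ (ℤ.+ (a + b)) 0                      ≈⟨ *≡* (cong (ℤ._* ℤ.1ℤ) (cong₂ ℤ._+_ (sym (ℤₚ.*-identityʳ (ℤ.+ a))) (sym (ℤₚ.*-identityʳ (ℤ.+ b))))) ⟩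
  mkℚᵘ (ℤ.+ a) 0 ℚᵘ.+ mkℚᵘ (ℤ.+ b) 0        ≈⟨ ℚᵘₚ.+-cong (toℚᵘ-fromℕ a) (toℚᵘ-fromℕ b) ⟨
  ℚ.toℚᵘ (fromℕ a) ℚᵘ.+ ℚ.toℚᵘ (fromℕ b)    ≈⟨ ℚₚ.toℚᵘ-homo-+ (fromℕ a) (fromℕ b) ⟨
  ℚ.toℚᵘ (fromℕ a ℚ.+ fromℕ b)              ∎)
  where open import Relation.Binary.Reasoning.Setoid ℚᵘₚ.≃-setoid

fromℕ-* : ∀ a b → fromℕ (a * b) ≡ fromℕ a ℚ.* fromℕ b
fromℕ-* a b = ℚₚ.toℚᵘ-injective (begin
  ℚ.toℚᵘ (fromℕ (a * b))                    ≈⟨ toℚᵘ-fromℕ (a * b) ⟩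
  mkℚᵘ (ℤ.+ (a * b)) 0                      ≈⟨ *≡* (cong (ℤ._* ℤ.1ℤ) (ℤₚ.pos-* a b)) ⟩
  mkℚᵘ (ℤ.+ a) 0 ℚᵘ.* mkℚᵘ (ℤ.+ b) 0        ≈⟨ ℚᵘₚ.*-cong (toℚᵘ-fromℕ a) (toℚᵘ-fromℕ b) ⟨
  ℚ.toℚᵘ (fromℕ a) ℚᵘ.* ℚ.toℚᵘ (fromℕ b)    ≈⟨ ℚₚ.toℚᵘ-homo-* (fromℕ a) (fromℕ b) ⟨
  ℚ.toℚᵘ (fromℕ a ℚ.* fromℕ b)              ∎)
  where open import Relation.Binary.Reasoning.Setoid ℚᵘₚ.≃-setoid

fromℕ-invertible : ∀ d → d ≢ 0 → ∃ λ u → fromℕ d ℚ.* u ≡ ℚ.1ℚ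
fromℕ-invertible zero d≢0 = contradiction refl d≢0
fromℕ-invertible (suc d) _ = ℤ.1ℤ ℚ./ suc d , ℚₚ.toℚᵘ-injective (begin
  ℚ.toℚᵘ (fromℕ (suc d) ℚ.* (ℤ.1ℤ ℚ./ suc d))            ≈⟨ ℚₚ.toℚᵘ-homo-* (fromℕ (suc d)) (ℤ.1ℤ ℚ./ suc d) ⟩
  ℚ.toℚᵘ (fromℕ (suc d)) ℚᵘ.* ℚ.toℚᵘ (ℤ.1ℤ ℚ./ suc d)    ≈⟨ ℚᵘₚ.*-cong (toℚᵘ-fromℕ (suc d)) (ℚₚ.toℚᵘ-fromℚᵘ (mkℚᵘ ℤ.1ℤ d)) ⟩
  mkℚᵘ (ℤ.+ suc d) 0 ℚᵘ.* mkℚᵘ ℤ.1ℤ d                    ≈⟨ *≡* (trans (ℤₚ.*-identityʳ _) (trans (ℤₚ.*-identityʳ _)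
                                                              (sym (trans (ℤₚ.*-identityˡ _) (cong (λ m → ℤ.+ m) (+-identityʳ (suc d))))))) ⟩
  mkℚᵘ ℤ.1ℤ 0                                            ∎)
  where open import Relation.Binary.Reasoning.Setoid ℚᵘₚ.≃-setoid

-- The only φ needed is n ↦ + n / 1; it is kept abstract because its unfolding makes conversion checking blow up.
module _ (K : FiniteField) (φ : ℕ → ℚ) (φ-+ : ∀ a b → φ (a + b) ≡ φ a ℚ.+ φ b) (φ-* : ∀ a b → φ (a * b) ≡ φ a ℚ.* φ b) where
  open ℚ-Solver.+-*-Solver using (solve; _:+_; _:*_; _:-_; _:=_)

  sumℚ-difference : ∀ {m} (a b w : Fin m → ℕ) (u : ℚ) →
    sumℚ K (λ j → (φ (a j) ℚ.- φ (b j)) ℚ.* u ℚ.* φ (w j)) ≡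
    (φ (∑ (allFin m) (λ j → a j * w j)) ℚ.- φ (∑ (allFin m) (λ j → b j * w j))) ℚ.* u
  sumℚ-difference {zero} a b w u = sym (trans (cong (ℚ._* u) (ℚₚ.+-inverseʳ (φ 0))) (ℚₚ.*-zeroˡ u))
  sumℚ-difference {suc m} a b w u = begin
    (φ (a zero) ℚ.- φ (b zero)) ℚ.* u ℚ.* φ (w zero) ℚ.+ sumℚ K (λ j → (φ (a (suc j)) ℚ.- φ (b (suc j))) ℚ.* u ℚ.* φ (w (suc j)))
      ≡⟨ cong ((φ (a zero) ℚ.- φ (b zero)) ℚ.* u ℚ.* φ (w zero) ℚ.+_) (sumℚ-difference (a ∘ suc) (b ∘ suc) (w ∘ suc) u) ⟩
    (φ (a zero) ℚ.- φ (b zero)) ℚ.* u ℚ.* φ (w zero) ℚ.+ (φ (tail a) ℚ.- φ (tail b)) ℚ.* u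
      ≡⟨ solve 6 (λ a b w α β u → (a :- b) :* u :* w :+ (α :- β) :* u := ((a :* w :+ α) :- (b :* w :+ β)) :* u) refl
           (φ (a zero)) (φ (b zero)) (φ (w zero)) (φ (tail a)) (φ (tail b)) u ⟩
    ((φ (a zero) ℚ.* φ (w zero) ℚ.+ φ (tail a)) ℚ.- (φ (b zero) ℚ.* φ (w zero) ℚ.+ φ (tail b))) ℚ.* u
      ≡⟨ cong₂ (λ x y → (x ℚ.- y) ℚ.* u) (fold a) (fold b) ⟩
    (φ (∑ (allFin (suc m)) (λ j → a j * w j)) ℚ.- φ (∑ (allFin (suc m)) (λ j → b j * w j))) ℚ.* u ∎
    where
    open ≡-Reasoning
    tail : (Fin (suc m) → ℕ) → ℕ
    tail a = ∑ (allFin m) (λ j → a (suc j) * w (suc j))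
    fold : ∀ a → φ (a zero) ℚ.* φ (w zero) ℚ.+ φ (tail a) ≡ φ (∑ (allFin (suc m)) (λ j → a j * w j))
    fold a = trans (cong (ℚ._+ φ (tail a)) (sym (φ-* (a zero) (w zero))))
      (trans (sym (φ-+ (a zero * w zero) (tail a))) (cong φ (sym (∑-allFin-suc m (λ j → a j * w j)))))

  sumℚ-normalised : ∀ {m} (a b w : Fin m → ℕ) d u →
    ∑ (allFin m) (λ j → a j * w j) ≡ ∑ (allFin m) (λ j → b j * w j) + d → φ d ℚ.* u ≡ ℚ.1ℚ →
    sumℚ K (λ j → (φ (a j) ℚ.- φ (b j)) ℚ.* u ℚ.* φ (w j)) ≡ ℚ.1ℚ
  sumℚ-normalised {m} a b w d u eq du≡1 = begin
    sumℚ K (λ j → (φ (a j) ℚ.- φ (b j)) ℚ.* u ℚ.* φ (w j))    ≡⟨ sumℚ-difference a b w u ⟩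
    (φ (∑ (allFin m) (λ j → a j * w j)) ℚ.- φ β) ℚ.* u        ≡⟨ cong (λ x → (x ℚ.- φ β) ℚ.* u) (trans (cong φ eq) (φ-+ β d)) ⟩
    (φ β ℚ.+ φ d ℚ.- φ β) ℚ.* u                               ≡⟨ solve 3 (λ β d u → (β :+ d :- β) :* u := d :* u) refl (φ β) (φ d) u ⟩
    φ d ℚ.* u                                                 ≡⟨ du≡1 ⟩
    ℚ.1ℚ                                                      ∎
    where
    open ≡-Reasoning
    β = ∑ (allFin m) (λ j → b j * w j)

-- The weights are (a_j - b_j) / d. They may be negative, so counting delivers the identity with two
-- sums of natural numbers, and subtraction takes place only in the rationals.
rational-weights : ∀ (K : FiniteField) {X : Set} {m d} (a b : Fin m → ℕ) (w : Fin m → X → ℕ) → d ≢ 0 →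
  (∀ x → ∑ (allFin m) (λ j → a j * w j x) ≡ ∑ (allFin m) (λ j → b j * w j x) + d) →
  Σ (Fin m → ℚ) λ β → ∀ x → sumℚ K (λ j → β j ℚ.* (ℤ.+ w j x ℚ./ 1)) ≡ ℚ.1ℚ
rational-weights K {d = d} a b w d≢0 eq with fromℕ-invertible d d≢0
... | u , du≡1 = (λ j → (fromℕ (a j) ℚ.- fromℕ (b j)) ℚ.* u)
  , λ x → sumℚ-normalised K fromℕ fromℕ-+ fromℕ-* a b (λ j → w j x) d u (eq x) du≡1

-- The indicator selects the index `d`; if `d` lies beyond the range, the hypothesis makes the
-- missing term zero. This is what permits cutting off a sum over distances.
∑-allFin-toℕ : ∀ m (g : ℕ → ℕ) d → (m ≤ d → g d ≡ 0) → ∑ (allFin m) (λ j → g (toℕ j) * ⟦ d ℕ.≟ toℕ j ⟧) ≡ g d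
∑-allFin-toℕ m g d g≡0 with d ℕ.<? m
... | no d≮m = trans (∑-zero (allFin m) (λ j → trans (cong (g (toℕ j) *_) (⟦⟧-no (d ℕ.≟ toℕ j) (λ { refl → d≮m (Finₚ.toℕ<n j) })))
    (*-zeroʳ (g (toℕ j))))) (sym (g≡0 (≮⇒≥ d≮m)))
... | yes d<m = trans (∑-cong (allFin m) (λ j → trans (*-comm (g (toℕ j)) _) (cong (_* g (toℕ j))
      (⟦⟧-cong (d ℕ.≟ toℕ j) (j Fin.≟ Fin.fromℕ< d<m)
        (λ { refl → sym (Finₚ.fromℕ<-toℕ j d<m) }) (λ { refl → sym (Finₚ.toℕ-fromℕ< d<m) })))))
    (trans (∑-allFin-≟ (Fin.fromℕ< d<m) (g ∘ toℕ)) (cong g (Finₚ.toℕ-fromℕ< d<m)))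

-- Uniform packing and covering in the presence of the Steiner property

module SteinerNearMDS (K : FiniteField) {k t n : ℕ} (H : Matrix K (suc t) n) (k+r≡n : k + suc t ≡ n)
  (nmds : IsNearMDS K k (suc t) H)
  (steiner : ∀ p → ∣ p ∣ ≡ t → ∃ (CodeLemmas.Completes K H p)) where
  open NearMDSLemmas K {k} H k+r≡n nmds hiding (steiner)

  #agreeing-flags : ∀ p → ∣ p ∣ ≡ t → ∀ v →
    ∑ (allFin n) (λ i → ⟦ outside? p i ⟧ * #agreeing (p [ i ]≔ true) v) ≡ size K * #agreeing p v + k
  #agreeing-flags p ∣p∣≡t v with steiner p ∣p∣≡t
  -- Adding 1 at the completing point avoids subtraction: all k + 1 points outside `p` then
  -- contribute 1, and `i` contributes `qN` in addition.
  ... | i , completes = +-cancelʳ-≡ 1 _ _ (begin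
    X + 1                                                                       ≡⟨ cong (X +_) (∑-allFin-≟ i (λ _ → 1)) ⟨
    X + ∑ (allFin n) (λ j → ⟦ j Fin.≟ i ⟧ * 1)                                  ≡⟨ ∑-+ (allFin n) _ _ ⟨
    ∑ (allFin n) (λ j → ⟦ outside? p j ⟧ * #agreeing (p [ j ]≔ true) v + ⟦ j Fin.≟ i ⟧ * 1)
                                                                                ≡⟨ ∑-cong (allFin n) (λ j → pointwise j (j Fin.≟ i) (outside? p j)) ⟩
    ∑ (allFin n) (λ j → ⟦ j Fin.≟ i ⟧ * qN + ⟦ outside? p j ⟧)                  ≡⟨ ∑-+ (allFin n) _ _ ⟩
    ∑ (allFin n) (λ j → ⟦ j Fin.≟ i ⟧ * qN) + ∑ (allFin n) (λ j → ⟦ outside? p j ⟧)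
                                                                                ≡⟨ cong₂ _+_ (∑-allFin-≟ i (λ _ → qN)) outside≡ ⟩
    qN + (k + 1)                                                                ≡⟨ +-assoc qN k 1 ⟨
    qN + k + 1                                                                  ∎)
    where
    open ≡-Reasoning
    X = ∑ (allFin n) (λ i → ⟦ outside? p i ⟧ * #agreeing (p [ i ]≔ true) v)
    qN = size K * #agreeing p v
    outside≡ : ∑ (allFin n) (λ j → ⟦ outside? p j ⟧) ≡ k + 1
    outside≡ = +-cancelʳ-≡ t _ _ (trans (cong (∑ (allFin n) (λ j → ⟦ outside? p j ⟧) +_) (sym ∣p∣≡t))
      (trans (∑-outside p) (trans (sym k+r≡n) (sym (+-assoc k 1 t)))))
    pointwise : ∀ j (d : Dec (j ≡ i)) (o : Dec (lookup p j ≡ false)) →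
      ⟦ o ⟧ * #agreeing (p [ j ]≔ true) v + ⟦ d ⟧ * 1 ≡ ⟦ d ⟧ * qN + ⟦ o ⟧
    pointwise j (yes refl) (no j∈p) = contradiction (proj₁ completes) j∈p
    pointwise j (yes refl) (yes j∉p) = cong (_+ 1) (trans (+-identityʳ _) (trans
      (#agreeing-completed p i v (independent-small p (≤-reflexive ∣p∣≡t)) completes) (sym (+-identityʳ qN))))
    pointwise j (no j≢i) (no _) = refl
    pointwise j (no j≢i) (yes j∉p) = trans (+-identityʳ _) (trans (+-identityʳ _)
      (#agreeing≡1 (p [ j ]≔ true) (independent-insert p i j ∣p∣≡t completes j∉p j≢i)
        (trans (∣∣-insert p j j∉p) (cong suc ∣p∣≡t)) v))

  #agreeing-recurrence : ∀ v → suc t * ∑ (subsets n (suc t)) (λ p → #agreeing p v) ≡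
    size K * ∑ (subsets n t) (λ p → #agreeing p v) + (n C t) * k
  #agreeing-recurrence v = begin
    suc t * ∑ (subsets n (suc t)) (λ p → #agreeing p v)
      ≡⟨ ∑-flags n t (λ p → #agreeing p v) ⟩
    ∑ (subsets n t) (λ p → ∑ (allFin n) (λ i → ⟦ outside? p i ⟧ * #agreeing (p [ i ]≔ true) v))
      ≡⟨ ∑-cong-∈ (subsets n t) (λ {p} p∈ → #agreeing-flags p (∈subsets⇒∣∣ n t p∈) v) ⟩
    ∑ (subsets n t) (λ p → size K * #agreeing p v + k)
      ≡⟨ ∑-+ (subsets n t) _ _ ⟩
    ∑ (subsets n t) (λ p → size K * #agreeing p v) + ∑ (subsets n t) (λ _ → k)
      ≡⟨ cong₂ _+_ (∑-*ˡ (subsets n t) (size K) _) (trans (∑-const (subsets n t) k) (cong (_* k) (length-subsets n t))) ⟩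
    size K * ∑ (subsets n t) (λ p → #agreeing p v) + (n C t) * k ∎
    where open ≡-Reasoning

  -- Codewords are sorted by their distance j from `v`; each is counted once for every s-set
  -- containing the differing coordinates. Distances beyond t + 1 exceed `s` and admit no such set,
  -- so the sum may stop there.
  ∑-#agreeing : ∀ s → s ≤ suc t → ∀ v → ∑ (subsets n s) (λ p → #agreeing p v) ≡
    ∑ (allFin (suc (suc t))) (λ j → supersets (toℕ j) (n ∸ toℕ j) s * B K H (toℕ j) v)
  ∑-#agreeing s s≤r v = begin
    ∑ (subsets n s) (λ p → ∑ V (λ x → ⟦ agreeing? p v x ⟧))
      ≡⟨ ∑-swap (subsets n s) V _ ⟩
    ∑ V (λ x → ∑ (subsets n s) (λ p → ⟦ agreeing? p v x ⟧))
      ≡⟨ ∑-cong V (λ x → trans (∑-cong (subsets n s) (λ p → ⟦⟧-× (inCode? K H x) (agree? p v x)))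
           (trans (∑-*ˡ (subsets n s) ⟦ inCode? K H x ⟧ _) (cong (⟦ inCode? K H x ⟧ *_) (trans (∑-agree n s v x) (sym (by-distance x)))))) ⟩
    ∑ V (λ x → ⟦ inCode? K H x ⟧ * ∑ Js (λ j → g (toℕ j) * ⟦ dist K v x ℕ.≟ toℕ j ⟧))
      ≡⟨ ∑-cong V (λ x → sym (∑-*ˡ Js ⟦ inCode? K H x ⟧ _)) ⟩
    ∑ V (λ x → ∑ Js (λ j → ⟦ inCode? K H x ⟧ * (g (toℕ j) * ⟦ dist K v x ℕ.≟ toℕ j ⟧)))
      ≡⟨ ∑-swap V Js _ ⟩
    ∑ Js (λ j → ∑ V (λ x → ⟦ inCode? K H x ⟧ * (g (toℕ j) * ⟦ dist K v x ℕ.≟ toℕ j ⟧)))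
      ≡⟨ ∑-cong Js (λ j → trans (∑-cong V (rearrange j)) (trans (∑-*ˡ V (g (toℕ j)) _)
           (cong (g (toℕ j) *_) (sym (length-filter≡∑ (λ x → inCode? K H x ×-dec (dist K v x ℕ.≟ toℕ j)) V))))) ⟩
    ∑ Js (λ j → g (toℕ j) * B K H (toℕ j) v) ∎
    where
    open ≡-Reasoning
    V = allVectors K n
    Js = allFin (suc (suc t))
    g : ℕ → ℕ
    g j = supersets j (n ∸ j) s
    by-distance : ∀ x → ∑ Js (λ j → g (toℕ j) * ⟦ dist K v x ℕ.≟ toℕ j ⟧) ≡ g (dist K v x)
    by-distance x = ∑-allFin-toℕ (suc (suc t)) g (dist K v x)
      (λ r<d → supersets-small (dist K v x) (n ∸ dist K v x) s (≤-trans (s≤s s≤r) r<d))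
    rearrange : ∀ j x → ⟦ inCode? K H x ⟧ * (g (toℕ j) * ⟦ dist K v x ℕ.≟ toℕ j ⟧) ≡
      g (toℕ j) * ⟦ inCode? K H x ×-dec (dist K v x ℕ.≟ toℕ j) ⟧
    rearrange j x = trans (solve 3 (λ a b c → a :* (b :* c) := b :* (a :* c)) refl
        ⟦ inCode? K H x ⟧ (g (toℕ j)) ⟦ dist K v x ℕ.≟ toℕ j ⟧)
      (cong (g (toℕ j) *_) (sym (⟦⟧-× (inCode? K H x) (dist K v x ℕ.≟ toℕ j))))
      where open +-*-Solver using (solve; _:*_; _:=_)

  nCt*k≢0 : (n C t) * k ≢ 0
  nCt*k≢0 eq with subset-of-size {t} (<⇒≤ (≤-trans (n≤1+n (suc t)) r<n))
  ... | p , ∣p∣≡t = <⇒≢ (*-mono-≤ 1≤nCt 1≤k) (sym eq)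
    where
    1≤nCt : 1 ≤ n C t
    1≤nCt = ≤-trans (∈⇒≤∑ (λ _ → 1) (subst (λ s → p ∈ subsets n s) ∣p∣≡t (∈subsets p)))
      (≤-reflexive (trans (sym (length≡∑1 (subsets n t))) (length-subsets n t)))

  upws : IsUPWS K H (suc t)
  upws = rational-weights K a b (λ j v → B K H (toℕ j) v) nCt*k≢0 identity
    where
    Js = allFin (suc (suc t))
    a b : Fin (suc (suc t)) → ℕ
    a j = suc t * supersets (toℕ j) (n ∸ toℕ j) (suc t)
    b j = size K * supersets (toℕ j) (n ∸ toℕ j) t
    scale : ∀ c s → s ≤ suc t → ∀ v → ∑ Js (λ j → c * supersets (toℕ j) (n ∸ toℕ j) s * B K H (toℕ j) v) ≡
      c * ∑ (subsets n s) (λ p → #agreeing p v)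
    scale c s s≤r v = trans (∑-cong Js (λ j → *-assoc c (supersets (toℕ j) (n ∸ toℕ j) s) (B K H (toℕ j) v)))
      (trans (∑-*ˡ Js c _) (cong (c *_) (sym (∑-#agreeing s s≤r v))))
    identity : ∀ v → ∑ Js (λ j → a j * B K H (toℕ j) v) ≡ ∑ Js (λ j → b j * B K H (toℕ j) v) + (n C t) * k
    identity v = trans (scale (suc t) (suc t) ≤-refl v)
      (trans (#agreeing-recurrence v) (cong (_+ (n C t) * k) (sym (scale (size K) t (n≤1+n t) v))))

  abstract
    -- Since t + 1 < n, a coordinate remains outside `p` and its completing point, and by uniqueness
    -- it does not complete `p`.
    independent-extension : ∀ p → ∣ p ∣ ≡ t → ∃ λ j → ∃ λ i →
      Completes p i × lookup p j ≡ false × j ≢ i × ∣ p [ j ]≔ true ∣ ≡ suc t × IndependentOn (p [ j ]≔ true)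
    independent-extension p ∣p∣≡t with steiner p ∣p∣≡t
    ... | i , completes with ∃-outside (p [ i ]≔ true)
            (≤-trans (s≤s (≤-reflexive (trans (∣∣-insert p i (proj₁ completes)) (cong suc ∣p∣≡t)))) r<n)
    ... | j , out with false∉insert p out
    ... | j≢i , j∉p = j , i , completes , j∉p , j≢i , trans (∣∣-insert p j j∉p) (cong suc ∣p∣≡t)
      , independent-insert p i j ∣p∣≡t completes j∉p j≢i

    independent-set : ∃ λ p → ∣ p ∣ ≡ suc t × IndependentOn p
    independent-set = extend (subset-of-size {t} (<⇒≤ (≤-trans (n≤1+n (suc t)) r<n)))
      where
      extend : ∃ (λ (p : Subset n) → ∣ p ∣ ≡ t) → ∃ λ p → ∣ p ∣ ≡ suc t × IndependentOn p
      extend (p , ∣p∣≡t) =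
        let j , _ , _ , _ , _ , ∣pj∣≡r , independent = independent-extension p ∣p∣≡t in p [ j ]≔ true , ∣pj∣≡r , independent

  covers-r : Covers K H (suc t)
  covers-r v with independent-set
  ... | p , ∣p∣≡r , independent with agreeing-exists p independent ∣p∣≡r v
  ... | x , hx , agree = x , hx , ≤-trans (dist≤∣∣ p agree) (≤-reflexive ∣p∣≡r)

  -- For a basis `p` with `j` added, `v` differs from some codeword by `e` supported there. The
  -- pairing of `c` with the syndrome of `v` reduces to `row c j ⊗ e j`, and `row c j` is nonzero,
  -- so the error at `j` disappears.
  near-codeword : ∀ c p v → ¬ IsZero K c → (∀ i → lookup p i ≡ true → row c i ≡ 0#) → ∣ p ∣ ≡ t →
    sumK K (λ j → c j ⊗ syn v j) ≡ 0# → ∃ λ x → InCode K H x × dist K v x ≤ t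
  near-codeword c p v c≢0 vanish ∣p∣≡t c·s≡0 with independent-extension p ∣p∣≡t
  ... | j , i , completes , j∉p , j≢i , ∣pj∣ , independent with agreeing-exists (p [ j ]≔ true) independent ∣pj∣ v
  ... | x , hx , agree = x , hx , ≤-trans (dist≤∣∣ p agree-p) (≤-reflexive ∣p∣≡t)
    where
    e : Vector A n
    e l = ⊖ 1# ⊗ x l ⊕ v l
    open ≡-Reasoning
    row·e≡0 : row c j ⊗ e j ≡ 0#
    row·e≡0 = begin
      row c j ⊗ e j                                              ≡⟨ sumK-single j others ⟨
      sumK K (λ l → row c l ⊗ e l)                               ≡⟨ dot-⊕ (row c) x v (⊖ 1#) ⟩
      ⊖ 1# ⊗ sumK K (λ l → row c l ⊗ x l) ⊕ sumK K (λ l → row c l ⊗ v l)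
                                                                 ≡⟨ cong₂ (λ a b → ⊖ 1# ⊗ a ⊕ b) (sym (dot-syn c x)) (sym (dot-syn c v)) ⟩
      ⊖ 1# ⊗ sumK K (λ l → c l ⊗ syn x l) ⊕ sumK K (λ l → c l ⊗ syn v l)
                                                                 ≡⟨ cong₂ (λ a b → ⊖ 1# ⊗ a ⊕ b) (sumK-zero (λ l → trans (cong (c l ⊗_) (hx l)) (R.zeroʳ (c l)))) c·s≡0 ⟩
      ⊖ 1# ⊗ 0# ⊕ 0#                                             ≡⟨ -1x+x≡0 0# ⟩
      0#                                                         ∎
      where
      others : ∀ l → l ≢ j → row c l ⊗ e l ≡ 0#
      others l l≢j with lookup p l in eq
      ... | true = trans (cong (_⊗ e l) (vanish l eq)) (R.zeroˡ _)
      ... | false = trans (cong (row c l ⊗_) (trans (cong (λ a → ⊖ 1# ⊗ x l ⊕ a)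
          (agree l (trans (lookup-insert-other p l≢j) eq))) (-1x+x≡0 (x l)))) (R.zeroʳ _)
    eⱼ≡0 : e j ≡ 0#
    eⱼ≡0 = integral (row-uncompleted c p i j c≢0 vanish ∣p∣≡t completes j∉p j≢i) row·e≡0
    agree-p : Agree p v x
    agree-p l out with l Fin.≟ j
    ... | yes refl = sym (-1x+y≡0⇒x≡y eⱼ≡0)
    ... | no l≢j = agree l (trans (lookup-insert-other p l≢j) out)

  -- The columns in `p` have `s` in their span. One `p` serves all `c`, which leaves the choice of a
  -- `c` defined over the base field to the application.
  covered-syndrome : Covers K H t → ∀ (s : Vector A (suc t)) → ∃ λ p → ∣ p ∣ ≡ t ×
    (∀ c → (∀ i → lookup p i ≡ true → row c i ≡ 0#) → sumK K (λ j → c j ⊗ s j) ≡ 0#)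
  covered-syndrome covers s with independent-set
  ... | q , ∣q∣≡r , independent with syn-surjective-on q independent ∣q∣≡r s
  ... | v , _ , syn-v≗s with covers v
  ... | x , hx , d≤t with dist-subset v x d≤t (<⇒≤ (≤-trans (n≤1+n (suc t)) r<n))
  ... | p , ∣p∣≡t , agree = p , ∣p∣≡t , λ c vanish → begin
    sumK K (λ j → c j ⊗ s j)            ≡⟨ sumK-cong (λ j → cong (c j ⊗_) (syn-v≗s j)) ⟨
    sumK K (λ j → c j ⊗ syn v j)        ≡⟨ dot-syn c v ⟩
    sumK K (λ i → row c i ⊗ v i)        ≡⟨ sumK-cong (pointwise c vanish) ⟩
    sumK K (λ i → row c i ⊗ x i)        ≡⟨ dot-syn c x ⟨
    sumK K (λ j → c j ⊗ syn x j)        ≡⟨ sumK-zero (λ j → trans (cong (c j ⊗_) (hx j)) (R.zeroʳ (c j))) ⟩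
    0#                                  ∎
    where
    open ≡-Reasoning
    pointwise : ∀ c → (∀ i → lookup p i ≡ true → row c i ≡ 0#) → ∀ i → row c i ⊗ v i ≡ row c i ⊗ x i
    pointwise c vanish i with lookup p i in eq
    ... | true = trans (cong (_⊗ v i) (vanish i eq)) (trans (R.zeroˡ _) (sym (trans (cong (_⊗ x i) (vanish i eq)) (R.zeroˡ _))))
    ... | false = cong (row c i ⊗_) (agree i eq)

  hasCoveringRadius : ¬ Covers K H t → HasCoveringRadius K H (suc t)
  hasCoveringRadius ¬covers = covers-r , λ R′ covers → decidable-stable (suc t ℕ.≤? R′) (λ r≰R′ →
    ¬covers (λ v → let x , hx , d≤ = covers v in x , hx , ≤-trans d≤ (≤-pred (≰⇒> r≰R′))))

-- The extension field as a vector space over the base field, and lifting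

module Extension (F K : FiniteField) (m : ℕ) (ι : Carrier F → Carrier K) (hom : IsFieldHom F K ι)
  (size≡ : size K ≡ size F ^ m) where
  private
    module F = FieldLemmas F
    module L = FieldLemmas K
  open L using (_⊕_; _⊗_; ⊖_; 0#; 1#; _≟_; module R; module RP)
  open IsFieldHom hom

  ι-0 : ι F.0# ≡ 0#
  ι-0 = RP.x+x≈x⇒x≈0 _ (trans (sym (hom-+ F.0# F.0#)) (cong ι (F.R.+-identityˡ F.0#)))

  ι-⊖ : ∀ x → ι (F.⊖ x) ≡ ⊖ ι x
  ι-⊖ x = RP.+-inverseʳ-unique _ _ (trans (sym (hom-+ x (F.⊖ x))) (trans (cong ι (F.R.-‿inverseʳ x)) ι-0))

  ι-≢0 : ∀ {x} → x ≢ F.0# → ι x ≢ 0#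
  ι-≢0 {x} x≢0 ιx≡0 with F.inverse x x≢0
  ... | y , xy≡1 = L.0≢1 (sym (begin
    1#            ≡⟨ hom-1 ⟨
    ι F.1#        ≡⟨ cong ι xy≡1 ⟨
    ι (x F.⊗ y)   ≡⟨ hom-* x y ⟩
    ι x ⊗ ι y     ≡⟨ cong (_⊗ ι y) ιx≡0 ⟩
    0# ⊗ ι y      ≡⟨ R.zeroˡ (ι y) ⟩
    0#            ∎))
    where open ≡-Reasoning

  ι-≡0 : ∀ {x} → x ≡ F.0# → ι x ≡ 0#
  ι-≡0 refl = ι-0

  ι-sum : ∀ {a} (f : Fin a → F.A) → ι (sumK F f) ≡ sumK K (ι ∘ f)
  ι-sum {zero} f = ι-0
  ι-sum {suc a} f = trans (hom-+ _ _) (cong (ι (f zero) ⊕_) (ι-sum (f ∘ suc)))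

  ι-dot : ∀ {a} (f g : Fin a → F.A) → sumK K (λ i → ι (f i) ⊗ ι (g i)) ≡ ι (sumK F (λ i → f i F.⊗ g i))
  ι-dot f g = trans (L.sumK-cong (λ i → sym (hom-* (f i) (g i)))) (sym (ι-sum (λ i → f i F.⊗ g i)))

  -- The combination of elements of K with coefficients in F.
  comb : ∀ {s} → (Fin s → L.A) → (Fin s → F.A) → L.A
  comb b c = sumK K (λ l → b l ⊗ ι (c l))

  comb-cong : ∀ {s} (b : Fin s → L.A) {c d} → c ≗ d → comb b c ≡ comb b d
  comb-cong b c≗d = L.sumK-cong (λ l → cong (λ a → b l ⊗ ι a) (c≗d l))

  comb-zero : ∀ {s} (b : Fin s → L.A) {c} → (∀ l → c l ≡ F.0#) → comb b c ≡ 0#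
  comb-zero b c≡0 = L.sumK-zero (λ l → trans (cong (b l ⊗_) (ι-≡0 (c≡0 l))) (R.zeroʳ (b l)))

  comb-axpy : ∀ {s} (b : Fin s → L.A) a c d → comb b (λ l → a F.⊗ c l F.⊕ d l) ≡ ι a ⊗ comb b c ⊕ comb b d
  comb-axpy b a c d = trans
    (L.sumK-cong (λ l → cong (b l ⊗_) (trans (hom-+ (a F.⊗ c l) (d l)) (cong (_⊕ ι (d l)) (hom-* a (c l))))))
    (L.dot-⊕ b (ι ∘ c) (ι ∘ d) (ι a))

  Independent : ∀ {s} → (Fin s → L.A) → Set
  Independent b = ∀ c → comb b c ≡ 0# → IsZero F c

  InSpan : ∀ {s} → (Fin s → L.A) → L.A → Set
  InSpan b x = ∃ λ c → comb b c ≡ x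

  inSpan? : ∀ {s} (b : Fin s → L.A) x → Dec (InSpan b x)
  inSpan? {s} b x = map′ (λ (i , h) → F.decode i , h)
    (λ (c , h) → F.encode c , trans (comb-cong b (F.decode-encode c)) h)
    (Finₚ.any? (λ i → comb b (F.decode {s} i) ≟ x))

  -- Choosing coefficients for every element of K would inject |F|^m elements into |F|^s coefficient
  -- vectors.
  ∃-outside-span : ∀ {s} (b : Fin s → L.A) → s < m → ∃ λ x → ¬ InSpan b x
  ∃-outside-span {s} b s<m with Finₚ.¬∀⟶∃¬ (size K) _ (λ i → inSpan? b (L.from i)) ¬all
    where
    ¬all : ¬ (∀ i → InSpan b (L.from i))
    ¬all span with Finₚ.pigeonhole (≤-trans (^-monoʳ-< (size F) F.1<size s<m) (≤-reflexive (sym size≡)))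
                     (λ i → F.encode (proj₁ (span i)))
    ... | i , j , i<j , eq = Finₚ.<⇒≢ i<j (L.from-injective (trans (sym (proj₂ (span i)))
            (trans (comb-cong b (F.encode-injective eq)) (proj₂ (span j)))))
  ... | i , h = L.from i , h

  independent-cons : ∀ {s} {b : Fin s → L.A} {x} → Independent b → ¬ InSpan b x → Independent (x ∷ᵥ b)
  independent-cons {b = b} {x} independent x∉ c h with c zero F.≟ F.0#
  ... | yes c₀≡0 = λ { zero → c₀≡0 ; (suc l) → independent (c ∘ suc)
        (trans (sym (R.+-identityˡ _)) (trans (cong (_⊕ comb b (c ∘ suc)) (sym (trans (cong (x ⊗_) (ι-≡0 c₀≡0)) (R.zeroʳ x)))) h)) l }
  ... | no c₀≢0 with F.inverse (c zero) c₀≢0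
  -- Solving the relation for `x` exhibits it in the span; the summand `F.0#` gives the coefficients
  -- the shape of `comb-axpy`.
  ... | u , c₀u≡1 = ⊥-elim (x∉ ((λ l → F.⊖ u F.⊗ c (suc l) F.⊕ F.0#) , (begin
    comb b (λ l → F.⊖ u F.⊗ c (suc l) F.⊕ F.0#)     ≡⟨ comb-axpy b (F.⊖ u) (c ∘ suc) (λ _ → F.0#) ⟩
    ι (F.⊖ u) ⊗ S ⊕ comb b (λ _ → F.0#)             ≡⟨ cong (ι (F.⊖ u) ⊗ S ⊕_) (comb-zero b (λ _ → refl)) ⟩
    ι (F.⊖ u) ⊗ S ⊕ 0#                              ≡⟨ R.+-identityʳ _ ⟩
    ι (F.⊖ u) ⊗ S                                   ≡⟨ cong (_⊗ S) (ι-⊖ u) ⟩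
    ⊖ ι u ⊗ S                                       ≡⟨ RP.-‿distribˡ-* (ι u) S ⟨
    ⊖ (ι u ⊗ S)                                     ≡⟨ RP.+-inverseˡ-unique x (ι u ⊗ S) scaled ⟨
    x                                               ∎)))
    where
    open ≡-Reasoning
    S = comb b (c ∘ suc)
    scaled : x ⊕ ι u ⊗ S ≡ 0#
    scaled = begin
      x ⊕ ι u ⊗ S                                ≡⟨ cong (_⊕ ι u ⊗ S) (R.*-identityʳ x) ⟨
      x ⊗ 1# ⊕ ι u ⊗ S                           ≡⟨ cong (λ a → x ⊗ a ⊕ ι u ⊗ S) (trans (sym (hom-* (c zero) u)) (trans (cong ι c₀u≡1) hom-1)) ⟨
      x ⊗ (ι (c zero) ⊗ ι u) ⊕ ι u ⊗ S           ≡⟨ cong (_⊕ ι u ⊗ S) (trans (sym (R.*-assoc x _ _)) (R.*-comm _ (ι u))) ⟩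
      ι u ⊗ (x ⊗ ι (c zero)) ⊕ ι u ⊗ S           ≡⟨ R.distribˡ (ι u) _ S ⟨
      ι u ⊗ (x ⊗ ι (c zero) ⊕ S)                 ≡⟨ cong (ι u ⊗_) h ⟩
      ι u ⊗ 0#                                   ≡⟨ R.zeroʳ (ι u) ⟩
      0#                                         ∎

  independent-family : ∀ s → s ≤ m → ∃ λ (b : Fin s → L.A) → Independent b
  independent-family zero _ = (λ ()) , λ c h ()
  independent-family (suc s) s<m with independent-family s (<⇒≤ s<m)
  ... | b , independent with ∃-outside-span b s<m
  ... | x , x∉ = x ∷ᵥ b , independent-cons independent x∉

  -- With more than m elements, two coefficient vectors have the same combination, and their
  -- difference is a nontrivial relation.
  independent⇒≤ : ∀ {s} (b : Fin s → L.A) → Independent b → s ≤ m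
  independent⇒≤ {s} b independent = decidable-stable (s ℕ.≤? m) (λ s≰m → absurd (≰⇒> s≰m))
    where
    absurd : ¬ m < s
    absurd m<s with F.collision (λ c → L.to (comb b c)) (≤-trans (s≤s (≤-reflexive size≡)) (^-monoʳ-< (size F) F.1<size m<s))
    ... | c , d , c≢d , eq = c≢d (λ l → F.-1x+y≡0⇒x≡y (independent _ (begin
      comb b (λ l → F.⊖ F.1# F.⊗ c l F.⊕ d l)   ≡⟨ comb-axpy b (F.⊖ F.1#) c d ⟩
      ι (F.⊖ F.1#) ⊗ comb b c ⊕ comb b d        ≡⟨ cong₂ (λ a e → a ⊗ comb b c ⊕ e) (trans (ι-⊖ F.1#) (cong ⊖_ hom-1)) (sym (L.to-injective eq)) ⟩
      ⊖ 1# ⊗ comb b c ⊕ comb b c                ≡⟨ L.-1x+x≡0 (comb b c) ⟩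
      0#                                        ∎) l))
      where open ≡-Reasoning

  independent⇒spanning : ∀ {b : Fin m → L.A} → Independent b → ∀ x → InSpan b x
  independent⇒spanning {b} independent x =
    decidable-stable (inSpan? b x) (λ x∉ → <-irrefl refl (independent⇒≤ (x ∷ᵥ b) (independent-cons independent x∉)))

  abstract
    basis : Fin m → L.A
    basis = proj₁ (independent-family m ≤-refl)

    basis-independent : Independent basis
    basis-independent = proj₂ (independent-family m ≤-refl)

    coords : L.A → Fin m → F.A
    coords x = proj₁ (independent⇒spanning basis-independent x)

    comb-coords : ∀ x → comb basis (coords x) ≡ x
    comb-coords x = proj₂ (independent⇒spanning basis-independent x)

  -- Entries from F act on each coordinate over F separately. The family `b` is arbitrary because,
  -- besides the basis, it is used for an independent family in another extension.
  comb-dot : ∀ {a s} (b : Fin s → L.A) (M : Fin a → F.A) (γ : Fin a → Fin s → F.A) →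
    sumK K (λ j → ι (M j) ⊗ comb b (γ j)) ≡ comb b (λ l → sumK F (λ j → M j F.⊗ γ j l))
  comb-dot b M γ = begin
    sumK K (λ j → ι (M j) ⊗ comb b (γ j))
      ≡⟨ L.sumK-cong (λ j → sym (L.sumK-⊗ˡ (ι (M j)) (λ l → b l ⊗ ι (γ j l)))) ⟩
    sumK K (λ j → sumK K (λ l → ι (M j) ⊗ (b l ⊗ ι (γ j l))))
      ≡⟨ L.sumK-cong (λ j → L.sumK-cong (λ l → commute (M j) (b l) (γ j l))) ⟩
    sumK K (λ j → sumK K (λ l → b l ⊗ ι (M j F.⊗ γ j l)))
      ≡⟨ L.sumK-swap (λ j l → b l ⊗ ι (M j F.⊗ γ j l)) ⟩
    sumK K (λ l → sumK K (λ j → b l ⊗ ι (M j F.⊗ γ j l)))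
      ≡⟨ L.sumK-cong (λ l → trans (L.sumK-⊗ˡ (b l) (λ j → ι (M j F.⊗ γ j l))) (cong (b l ⊗_) (sym (ι-sum (λ j → M j F.⊗ γ j l))))) ⟩
    comb b (λ l → sumK F (λ j → M j F.⊗ γ j l)) ∎
    where
    open ≡-Reasoning
    commute : ∀ x y z → ι x ⊗ (y ⊗ ι z) ≡ y ⊗ ι (x F.⊗ z)
    commute x y z = trans (sym (R.*-assoc _ _ _)) (trans (cong (_⊗ ι z) (R.*-comm (ι x) y))
      (trans (R.*-assoc _ _ _) (cong (y ⊗_) (sym (hom-* x z)))))

  dot-coords : ∀ {a} (M : Fin a → F.A) (x : Fin a → L.A) →
    sumK K (λ j → ι (M j) ⊗ x j) ≡ comb basis (λ l → sumK F (λ j → M j F.⊗ coords (x j) l))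
  dot-coords M x = trans (L.sumK-cong (λ j → cong (ι (M j) ⊗_) (sym (comb-coords (x j))))) (comb-dot basis M (λ j → coords (x j)))

  coords-≡0 : ∀ {x} → x ≡ 0# → ∀ l → coords x l ≡ F.0#
  coords-≡0 {x} x≡0 = basis-independent (coords x) (trans (comb-coords x) x≡0)

  coords-≢0 : ∀ {x} → x ≢ 0# → ∃ λ l → coords x l ≢ F.0#
  coords-≢0 {x} x≢0 = F.¬IsZero⇒∃ (coords x) (λ h → x≢0 (trans (sym (comb-coords x)) (comb-zero basis h)))

  wt-≤ : ∀ {n} (y : Fin n → F.A) (x : Fin n → L.A) → (∀ i → x i ≡ 0# → y i ≡ F.0#) → wt F y ≤ wt K x
  wt-≤ y x h = countFin-mono F K (λ i → ¬? (y i F.≟ F.0#)) (λ i → ¬? (x i ≟ 0#)) (λ i yᵢ≢0 xᵢ≡0 → yᵢ≢0 (h i xᵢ≡0))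

  wt-ι : ∀ {n} (y : Fin n → F.A) → wt K (ι ∘ y) ≡ wt F y
  wt-ι y = ≤-antisym
    (countFin-mono K F (λ i → ¬? (ι (y i) ≟ 0#)) (λ i → ¬? (y i F.≟ F.0#)) (λ i ιyᵢ≢0 yᵢ≡0 → ιyᵢ≢0 (ι-≡0 yᵢ≡0)))
    (wt-≤ y (ι ∘ y) (λ i ιyᵢ≡0 → decidable-stable (y i F.≟ F.0#) (λ yᵢ≢0 → ι-≢0 yᵢ≢0 ιyᵢ≡0)))

  ι-nonzero : ∀ {n} {y : Fin n → F.A} → ¬ IsZero F y → ¬ IsZero K (ι ∘ y)
  ι-nonzero {y = y} y≢0 ιy≡0 = y≢0 (λ i → decidable-stable (y i F.≟ F.0#) (λ yᵢ≢0 → ι-≢0 yᵢ≢0 (ιy≡0 i)))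

  module Lifting {r n : ℕ} (H : Matrix F r n) where
    Hᴷ : Matrix K r n
    Hᴷ = lift F K ι H

    ι-codeword : ∀ {x} → InCode F H x → InCode K Hᴷ (ι ∘ x)
    ι-codeword {x} h j = trans (ι-dot (H j) x) (ι-≡0 (h j))

    ι-row : ∀ c i → sumK K (λ j → ι (c j) ⊗ Hᴷ j i) ≡ ι (sumK F (λ j → c j F.⊗ H j i))
    ι-row c i = ι-dot c (λ j → H j i)

    row-coords : ∀ c i → sumK K (λ j → c j ⊗ Hᴷ j i) ≡ comb basis (λ l → sumK F (λ j → coords (c j) l F.⊗ H j i))
    row-coords c i = trans (L.sumK-cong (λ j → R.*-comm (c j) (Hᴷ j i)))
      (trans (dot-coords (λ j → H j i) c) (comb-cong basis (λ l → F.sumK-cong (λ j → F.R.*-comm (H j i) _))))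

    lift-fullRank : FullRank F H → FullRank K Hᴷ
    lift-fullRank fullRank c h j = trans (sym (comb-coords (c j))) (comb-zero basis (λ l →
      fullRank (λ j → coords (c j) l) (λ i → basis-independent _ (trans (sym (row-coords c i)) (h i)) l) j))

    -- A nonzero codeword over K has a nonzero coordinate word over F, again a codeword and with no
    -- larger support. Minimum weight is attained by the image of a codeword over F.
    lift-minDist : ∀ {d} → HasMinDist F (InCode F H) d → HasMinDist K (InCode K Hᴷ) d
    lift-minDist {d} (bound , x , hx , x≢0 , wt≡d) = bound′ , ι ∘ x , ι-codeword hx , ι-nonzero x≢0 , trans (wt-ι x) wt≡d
      where
      bound′ : ∀ x → InCode K Hᴷ x → ¬ IsZero K x → d ≤ wt K x
      bound′ x hx x≢0 with L.¬IsZero⇒∃ x x≢0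
      ... | i , xᵢ≢0 with coords-≢0 xᵢ≢0
      ... | l , xᵢₗ≢0 = ≤-trans
        (bound (λ i → coords (x i) l) (λ j → basis-independent _ (trans (sym (dot-coords (H j) x)) (hx j)) l) (λ h → xᵢₗ≢0 (h i)))
        (wt-≤ _ x (λ i xᵢ≡0 → coords-≡0 xᵢ≡0 l))

    -- Coordinates are taken of the coefficients `c`, not of `y`, so that the resulting word over F
    -- is visibly a combination of rows of `H`.
    lift-dualDist : ∀ {d} → HasMinDist F (InDual F H) d → HasMinDist K (InDual K Hᴷ) d
    lift-dualDist {d} (bound , y , (c , hy) , y≢0 , wt≡d) =
      bound′ , ι ∘ y , (ι ∘ c , λ i → trans (cong ι (hy i)) (sym (ι-row c i))) , ι-nonzero y≢0 , trans (wt-ι y) wt≡d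
      where
      bound′ : ∀ y → InDual K Hᴷ y → ¬ IsZero K y → d ≤ wt K y
      bound′ y (c , hy) y≢0 with L.¬IsZero⇒∃ y y≢0
      ... | i , yᵢ≢0 with F.¬IsZero⇒∃ (λ l → sumK F (λ j → coords (c j) l F.⊗ H j i))
              (λ h → yᵢ≢0 (trans (hy i) (trans (row-coords c i) (comb-zero basis h))))
      ... | l , yᵢₗ≢0 = ≤-trans
        (bound (λ i → sumK F (λ j → coords (c j) l F.⊗ H j i)) ((λ j → coords (c j) l) , λ _ → refl) (λ h → yᵢₗ≢0 (h i)))
        (wt-≤ _ y (λ i yᵢ≡0 → basis-independent _ (trans (sym (row-coords c i)) (trans (sym (hy i)) yᵢ≡0)) l))

    lift-nearMDS : ∀ {k} → IsNearMDS F k r H → IsNearMDS K k r Hᴷ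
    lift-nearMDS (fullRank , minDist , dualDist) = lift-fullRank fullRank , lift-minDist minDist , lift-dualDist dualDist

    lift-completes : ∀ p i → CodeLemmas.Completes F H p i → CodeLemmas.Completes K Hᴷ p i
    lift-completes p i (i∉p , z , hz , sz , zᵢ≢0) =
      i∉p , ι ∘ z , ι-codeword hz , (λ j out → ι-≡0 (sz j out)) , ι-≢0 zᵢ≢0

-- The family of lifted codes

module LiftedFamily {n k t : ℕ} (F : FiniteField) (H : Matrix F (suc t) n) (k+r≡n : k + suc t ≡ n)
  (nmds : IsNearMDS F k (suc t) H) (count : A[_] F (suc t) H * suc t ≡ (n C (k + 1)) * (size F ∸ 1))
  (K : ℕ → FiniteField) (size≡ : ∀ m → 1 ≤ m → size (K m) ≡ size F ^ m)
  (ι : ∀ m → Carrier F → Carrier (K m)) (hom : ∀ m → 1 ≤ m → IsFieldHom F (K m) (ι m)) where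
  private
    module F = NearMDSLemmas F H k+r≡n nmds

    module Lifted (m : ℕ) (1≤m : 1 ≤ m) where
      open Extension F (K m) m (ι m) (hom m 1≤m) (size≡ m 1≤m) public
      open Lifting H public

      lift-steiner : ∀ p → ∣ p ∣ ≡ t → ∃ (CodeLemmas.Completes (K m) Hᴷ p)
      lift-steiner p ∣p∣≡t = let i , completes = F.steiner count p ∣p∣≡t in i , lift-completes p i completes

      open SteinerNearMDS (K m) Hᴷ k+r≡n (lift-nearMDS nmds) lift-steiner public
      open FieldLemmas (K m) public using (sumK-cong; module R)

  conclusion : ∀ m → 1 ≤ m → ¬ Covers (K m) (lift F (K m) (ι m) H) t →
    HasCoveringRadius (K m) (lift F (K m) (ι m) H) (suc t)
    × IsUPWS (K m) (lift F (K m) (ι m) H) (suc t)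
    × IsNearMDS (K m) k (suc t) (lift F (K m) (ι m) H)
  conclusion m 1≤m ¬covers = M.hasCoveringRadius ¬covers , M.upws , M.lift-nearMDS nmds
    where module M = Lifted m 1≤m

  -- The t columns spanning `s` are columns of a matrix over F, so they have an annihilator already
  -- over F, and its image under `ι m` kills `s`.
  covered⇒rational-relation : ∀ m (1≤m : 1 ≤ m) → Covers (K m) (lift F (K m) (ι m) H) t → ∀ s →
    ∃₂ λ p c → ∣ p ∣ ≡ t × ¬ IsZero F c × (∀ i → lookup p i ≡ true → F.row c i ≡ F.0#) ×
      sumK (K m) (λ j → FiniteField._*_ (K m) (ι m (c j)) (s j)) ≡ FiniteField.0# (K m)
  covered⇒rational-relation m 1≤m covers s = annihilate (M.covered-syndrome covers s)
    where
    module M = Lifted m 1≤m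
    annihilate : _ → _
    annihilate (p , ∣p∣≡t , h) =
      let c , c≢0 , vanish = F.annihilator p (s≤s (≤-reflexive ∣p∣≡t))
      in p , c , ∣p∣≡t , c≢0 , vanish , h (ι m ∘ c) (λ i in′ → trans (M.ι-row c i) (M.ι-≡0 (vanish i in′)))

  uncovered : ∀ m → suc t ≤ m → ∀ 1≤m → ¬ Covers (K m) (lift F (K m) (ι m) H) t
  uncovered m r≤m 1≤m covers = contra (M.independent-family (suc t) r≤m)
    where
    module M = Lifted m 1≤m
    contra : ¬ ∃ (M.Independent {suc t})
    contra (b , independent) =
      let _ , c , _ , c≢0 , _ , c·b≡0 = covered⇒rational-relation m 1≤m covers b
      in c≢0 (independent c (trans (M.sumK-cong (λ j → M.R.*-comm (b j) (ι m (c j)))) c·b≡0))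

  -- A syndrome over K m′ is carried to K m by an F-linear injection K m′ → K m; it keeps exactly the F-linear relations
  -- between the coordinates, and these decide whether the syndrome is covered. (K m need not contain K m′ as a field.)
  covers-descends : ∀ m m′ 1≤m 1≤m′ → m′ ≤ m →
    Covers (K m) (lift F (K m) (ι m) H) t → Covers (K m′) (lift F (K m′) (ι m′) H) t
  covers-descends m m′ 1≤m 1≤m′ m′≤m covers v = near (M.independent-family m′ m′≤m)
    where
    module M = Lifted m 1≤m
    module M′ = Lifted m′ 1≤m′
    s = CodeLemmas.syn (K m′) M′.Hᴷ v
    γ : Fin (suc t) → Fin m′ → Carrier F
    γ j = M′.coords (s j)
    near : ∃ (M.Independent {m′}) → ∃ λ x → InCode (K m′) M′.Hᴷ x × dist (K m′) v x ≤ t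
    near (b , independent) =
      -- The syndrome over `K m` with the same coordinates over F as `s`, expanded in the
      -- independent family `b`. Independence of `b` then returns the relation to the coordinates,
      -- hence to `s`.
      let p , c , ∣p∣≡t , c≢0 , vanish , relation = covered⇒rational-relation m 1≤m covers (λ j → M.comb b (γ j))
          relation-F = independent _ (trans (sym (M.comb-dot b c γ)) relation)
      in M′.near-codeword (ι m′ ∘ c) p v (M′.ι-nonzero c≢0)
           (λ i in′ → trans (M′.ι-row c i) (M′.ι-≡0 (vanish i in′))) ∣p∣≡t
           (trans (M′.dot-coords c s) (M′.comb-zero M′.basis relation-F))

  lifted-codes :
    ((m : ℕ) → suc t ≤ m →
      HasCoveringRadius (K m) (lift F (K m) (ι m) H) (suc t)
      × IsUPWS (K m) (lift F (K m) (ι m) H) (suc t)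
      × IsNearMDS (K m) k (suc t) (lift F (K m) (ι m) H))
    ×
    ((m′ : ℕ) → 1 ≤ m′ → m′ < suc t →
      HasCoveringRadius (K m′) (lift F (K m′) (ι m′) H) (suc t) →
      (m : ℕ) → m′ ≤ m →
        HasCoveringRadius (K m) (lift F (K m) (ι m) H) (suc t)
        × IsUPWS (K m) (lift F (K m) (ι m) H) (suc t)
        × IsNearMDS (K m) k (suc t) (lift F (K m) (ι m) H))
  lifted-codes =
      (λ m r≤m → conclusion m (≤-trans (s≤s z≤n) r≤m) (uncovered m r≤m (≤-trans (s≤s z≤n) r≤m)))
    -- If radius t covered over `K m`, it would cover over `K m′`, against minimality of t + 1
    -- there.
    , (λ m′ 1≤m′ _ (_ , minimal) m m′≤m → let 1≤m = ≤-trans 1≤m′ m′≤m in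
        conclusion m 1≤m (λ covers → <-irrefl refl (minimal t (covers-descends m m′ 1≤m 1≤m′ m′≤m covers))))

-- The redundancy `n ∸ k` is generalised to a variable `r`, so that it can be matched with `suc t`
-- in the types of the matrices.
lifted-family : ∀ {n k} r (F : FiniteField) (H : Matrix F r n) → 0 < r → k + r ≡ n → IsNearMDS F k r H →
    A[_] F r H * r ≡ (n C (k + 1)) * (size F ∸ 1) →
    (K : ℕ → FiniteField) → (∀ m → 1 ≤ m → size (K m) ≡ size F ^ m) →
    (ι : ∀ m → Carrier F → Carrier (K m)) → (∀ m → 1 ≤ m → IsFieldHom F (K m) (ι m)) →
    ((m : ℕ) → r ≤ m →
      HasCoveringRadius (K m) (lift F (K m) (ι m) H) r
      × IsUPWS (K m) (lift F (K m) (ι m) H) r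
      × IsNearMDS (K m) k r (lift F (K m) (ι m) H))
    ×
    ((m′ : ℕ) → 1 ≤ m′ → m′ < r →
      HasCoveringRadius (K m′) (lift F (K m′) (ι m′) H) r →
      (m : ℕ) → m′ ≤ m →
        HasCoveringRadius (K m) (lift F (K m) (ι m) H) r
        × IsUPWS (K m) (lift F (K m) (ι m) H) r
        × IsNearMDS (K m) k r (lift F (K m) (ι m) H))
lifted-family (suc t) F H _ k+r≡n nmds count K size≡ ι hom =
  LiftedFamily.lifted-codes F H k+r≡n nmds count K size≡ ι hom

theorem3p8 : (n k : ℕ) (F : FiniteField) (H : Matrix F (n ∸ k) n) →
    k < n →
    IsNMDS F n k H →
    A[_] F (n ∸ k) H * (n ∸ k) ≡ (n C (k + 1)) * (size F ∸ 1) →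
    (K : ℕ → FiniteField) →
    (∀ m → 1 ≤ m → size (K m) ≡ size F ^ m) →
    (ι : ∀ m → Carrier F → Carrier (K m)) →
    (∀ m → 1 ≤ m → IsFieldHom F (K m) (ι m)) →
    ((m : ℕ) → n ∸ k ≤ m →
    HasCoveringRadius (K m) (lift F (K m) (ι m) H) (n ∸ k)
    × IsUPWS (K m) (lift F (K m) (ι m) H) (n ∸ k)
    × IsNMDS (K m) n k (lift F (K m) (ι m) H))
    ×
    ((m′ : ℕ) → 1 ≤ m′ → m′ < n ∸ k →
    HasCoveringRadius (K m′) (lift F (K m′) (ι m′) H) (n ∸ k) →
    (m : ℕ) → m′ ≤ m →
    HasCoveringRadius (K m) (lift F (K m) (ι m) H) (n ∸ k)
    × IsUPWS (K m) (lift F (K m) (ι m) H) (n ∸ k)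
    × IsNMDS (K m) n k (lift F (K m) (ι m) H))
theorem3p8 n k F H k<n nmds = lifted-family (n ∸ k) F H (m<n⇒0<n∸m k<n) (m+[n∸m]≡n (<⇒≤ k<n)) nmds
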